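{- Let $q$ be a prime power, let $n,t,u$ be positive integers with $\gcd(u,n)=1$, and let $\sigma\colon x\mapsto x^{q^u}$, an automorphism of $\mathbb{F}_{q^{nt}}$ (whose restriction generates $\mathrm{Gal}(\mathbb{F}_{q^n}\colon\mathbb{F}_q)$). Let $b_0,\dots,b_{t-1}\in\mathbb{F}_{q^{nt}}$ and \[ f(x)=-x+b_0x^{\sigma}+b_1x^{\sigma q^n}+b_2x^{\sigma q^{2n}}+\cdots+b_{t-1}x^{\sigma q^{n(t-1)}}. \] Let $\tau=\sigma^{ -1}$, and let $s$ be the minimum integer such that $1\le s\le nt$ and $\tau\colon x\mapsto x^{q^s}$ on $\mathbb{F}_{q^{nt}}$. Let \[ J=\begin{pmatrix}0&1&0&\cdots&0&0\\0&0&1&\cdots&0&0\\ \vdots&\vdots&&&\vdots&\vdots\\0&0&0&\cdots&0&1\\1&0&0&\cdots&0&0\end{pmatrix},\qquad D=\begin{pmatrix}b_0&b_1&\cdots&b_{t-1}\\ b_{t-1}^{q^n}&b_0^{q^n}&\cdots&b_{t-2}^{q^n}\\ \vdots&\vdots&&\vdots\\ b_1^{q^{n(t-1)}}&b_2^{q^{n(t-1)}}&\cdots&b_0^{q^{n(t-1)}}\end{pmatrix} \] be $t\times t$ matrices over $\mathbb{F}_{q^{nt}}$. Then, for every integer $h$, $\dim_{\mathbb{F}_q}\ker f=h$ if and only if \[ \mathrm{rk}\left(D^{\tau^{n-1}}\cdot D^{\tau^{n-2}}\cdots D^{\tau}\cdot D-J^s\right)=t-h. \]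
   Context: Notation: $x^{\sigma q^{ni}}:=x^{q^{u+ni}}$. $\ker f$ is the set of roots of $f$ in $\mathbb{F}_{q^{nt}}$, an $\mathbb{F}_q$-subspace. For a matrix $M$ over $\mathbb{F}_{q^{nt}}$ and an automorphism $\rho$ of $\mathbb{F}_{q^{nt}}$, $M^{\rho}$ is the matrix obtained by applying $\rho$ to each entry. With rows and columns indexed by $0,\dots,t-1$, the $(i,j)$ entry of $D$ is $b_{j-i}^{q^{ni}}$ (index of $b$ modulo $t$), and the $(i,j)$ entry of $J$ is $1$ if $j\equiv i+1\pmod t$ and $0$ otherwise. -}

module Defs where

open import Algebra.Apartness.Bundles using (HeytingField; HeytingCommutativeRing)
open import Algebra.Bundles using (CommutativeRing)
open import Algebra.Module.Bundles using (LeftModule)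
open import Algebra.Morphism.Structures using (IsRingHomomorphism)
import Algebra.Properties.CommutativeMonoid.Sum as Sum
import Algebra.Properties.Semiring.Exp as Exp
open import Data.Bool.Base using (if_then_else_)
open import Data.Fin.Base using (Fin; toℕ)
import Data.Fin.Properties as Fin
open import Data.Nat.Base as ℕ using (ℕ; zero; suc; NonZero; _≤_)
open import Data.Nat.DivMod using (_mod_; _%_)
open import Data.Nat.GeneralisedArithmetic using (iterate)
open import Data.Nat.Primality using (Prime)
import Data.Nat.Properties as ℕ
open import Data.Product.Base using (_×_; _,_; ∃-syntax; Σ-syntax)
open import Data.Vec.Functional using (Vector)
open import Function.Bundles using (Inverse)
open import Function.Definitions using (Inverseᵇ)
open import Level using (Level; _⊔_)
open import Relation.Binary.PropositionalEquality as ≡ using (_≡_)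
open import Relation.Nullary.Decidable.Core using (does)
open import Relation.Unary using (Pred)

private
  variable
    a b c d ℓ ℓ₁ ℓ₂ m ℓm p : Level

IsPrimePower : ℕ → Set
IsPrimePower q = ∃[ p ] ∃[ k ] (Prime p × 1 ≤ k × q ≡ p ℕ.^ k)

IsLeast : Pred ℕ p → Pred ℕ p
IsLeast P s = P s × (∀ s′ → P s′ → s ≤ s′)

-- A field is a HeytingField: nontrivial, with x # y exactly when x - y is
-- invertible.  Together with HasOrder below, equality and invertibility are
-- decidable, so this is the usual notion of finite field: every element
-- that is not 0# has an inverse.
fieldRing : HeytingField c ℓ₁ ℓ₂ → CommutativeRing c ℓ₁
fieldRing K =
  HeytingCommutativeRing.commutativeRing (HeytingField.heytingCommutativeRing K)

HasOrder : CommutativeRing c ℓ → ℕ → Set (c ⊔ ℓ)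
HasOrder R N = Inverse (CommutativeRing.setoid R) (≡.setoid (Fin N))

module Dimension (F : CommutativeRing c ℓ)
                 (M : LeftModule (CommutativeRing.ring F) m ℓm) where
  open CommutativeRing F using (Carrier; _≈_; 0#)
  open LeftModule M using (Carrierᴹ; _≈ᴹ_; 0ᴹ; _*ₗ_; +ᴹ-commutativeMonoid)
  open Sum +ᴹ-commutativeMonoid using (sum)

  combination : ∀ {k} → Vector Carrier k → Vector Carrierᴹ k → Carrierᴹ
  combination α v = sum (λ i → α i *ₗ v i)

  LinearlyIndependent : ∀ {k} → Vector Carrierᴹ k → Set (c ⊔ ℓ ⊔ ℓm)
  LinearlyIndependent v = ∀ α → combination α v ≈ᴹ 0ᴹ → ∀ i → α i ≈ 0#

  IsBasis : Pred Carrierᴹ p → ∀ {k} → Vector Carrierᴹ k →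
            Set (c ⊔ ℓ ⊔ m ⊔ ℓm ⊔ p)
  IsBasis V v = (∀ i → V (v i))
              × LinearlyIndependent v
              × (∀ x → V x → ∃[ α ] (x ≈ᴹ combination α v))

  -- Meant for V a linear subspace of M.
  HasDimension : Pred Carrierᴹ p → ℕ → Set (c ⊔ ℓ ⊔ m ⊔ ℓm ⊔ p)
  HasDimension V k = ∃[ v ] IsBasis V {k} v

-- K as a vector space over F by restriction of scalars along ι.
module _ (F : CommutativeRing a ℓ₁) (K : CommutativeRing b ℓ₂)
         {ι : CommutativeRing.Carrier F → CommutativeRing.Carrier K}
         (hom : IsRingHomomorphism (CommutativeRing.rawRing F)
                                   (CommutativeRing.rawRing K) ι) where
  private module H = IsRingHomomorphism hom
  open CommutativeRing K

  restrictScalars : LeftModule (CommutativeRing.ring F) b ℓ₂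
  restrictScalars = record
    { Carrierᴹ = Carrier
    ; _≈ᴹ_ = _≈_
    ; _+ᴹ_ = _+_
    ; _*ₗ_ = λ α x → ι α * x
    ; 0ᴹ = 0#
    ; -ᴹ_ = -_
    ; isLeftModule = record
      { isLeftSemimodule = record
        { +ᴹ-isCommutativeMonoid = +-isCommutativeMonoid
        ; isPreleftSemimodule = record
          { *ₗ-cong = λ α≈β x≈y → *-cong (H.⟦⟧-cong α≈β) x≈y
          ; *ₗ-zeroˡ = λ x → trans (*-congʳ H.0#-homo) (zeroˡ x)
          ; *ₗ-distribʳ = λ x α β → trans (*-congʳ (H.+-homo α β)) (distribʳ x (ι α) (ι β))
          ; *ₗ-identityˡ = λ x → trans (*-congʳ H.1#-homo) (*-identityˡ x)
          ; *ₗ-assoc = λ α β x → trans (*-congʳ (H.*-homo α β)) (*-assoc (ι α) (ι β) x)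
          ; *ₗ-zeroʳ = λ α → zeroʳ (ι α)
          ; *ₗ-distribˡ = λ α → distribˡ (ι α)
          }
        }
      ; -ᴹ‿cong = -‿cong
      ; -ᴹ‿inverse = -‿inverse
      }
    }

module Matrices (K : CommutativeRing c ℓ) where
  open CommutativeRing K
  open Sum +-commutativeMonoid using (sum)

  Matrix : ℕ → ℕ → Set c
  Matrix k l = Vector (Vector Carrier l) k

  coordinateSpace : ℕ → LeftModule ring c ℓ
  coordinateSpace k = record
    { Carrierᴹ = Vector Carrier k
    ; _≈ᴹ_ = λ x y → ∀ i → x i ≈ y i
    ; _+ᴹ_ = λ x y i → x i + y i
    ; _*ₗ_ = λ α x i → α * x i
    ; 0ᴹ = λ _ → 0#
    ; -ᴹ_ = λ x i → - x i
    ; isLeftModule = record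
      { isLeftSemimodule = record
        { +ᴹ-isCommutativeMonoid = record
          { isMonoid = record
            { isSemigroup = record
              { isMagma = record
                { isEquivalence = record
                  { refl = λ _ → refl
                  ; sym = λ p i → sym (p i)
                  ; trans = λ p q i → trans (p i) (q i)
                  }
                ; ∙-cong = λ p q i → +-cong (p i) (q i)
                }
              ; assoc = λ x y z i → +-assoc (x i) (y i) (z i)
              }
            ; identity = (λ x i → +-identityˡ (x i)) , (λ x i → +-identityʳ (x i))
            }
          ; comm = λ x y i → +-comm (x i) (y i)
          }
        ; isPreleftSemimodule = record
          { *ₗ-cong = λ α≈β p i → *-cong α≈β (p i)
          ; *ₗ-zeroˡ = λ x i → zeroˡ (x i)
          ; *ₗ-distribʳ = λ x α β i → distribʳ (x i) α β
          ; *ₗ-identityˡ = λ x i → *-identityˡ (x i)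
          ; *ₗ-assoc = λ α β x i → *-assoc α β (x i)
          ; *ₗ-zeroʳ = λ α _ → zeroʳ α
          ; *ₗ-distribˡ = λ α x y i → distribˡ α (x i) (y i)
          }
        }
      ; -ᴹ‿cong = λ p i → -‿cong (p i)
      ; -ᴹ‿inverse = (λ x i → -‿inverseˡ (x i)) , (λ x i → -‿inverseʳ (x i))
      }
    }

  infixl 6 _⊖_
  infixl 7 _·_
  infixr 8 _^ᴹ_

  identity : ∀ k → Matrix k k
  identity k i j = if does (i Fin.≟ j) then 1# else 0#

  _·_ : ∀ {k l r} → Matrix k l → Matrix l r → Matrix k r
  (A · B) i j = sum (λ x → A i x * B x j)

  _⊖_ : ∀ {k l} → Matrix k l → Matrix k l → Matrix k l
  (A ⊖ B) i j = A i j - B i j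

  _^ᴹ_ : ∀ {k} → Matrix k k → ℕ → Matrix k k
  A ^ᴹ zero  = identity _
  A ^ᴹ suc e = A · A ^ᴹ e

  applyEntrywise : ∀ {k l} → (Carrier → Carrier) → Matrix k l → Matrix k l
  applyEntrywise ρ A i j = ρ (A i j)

  -- twistedProduct τ A e = A^{τ^{e-1}} · A^{τ^{e-2}} ⋯ A^τ · A
  twistedProduct : ∀ {k} → (Carrier → Carrier) → Matrix k k → ℕ → Matrix k k
  twistedProduct τ A zero    = identity _
  twistedProduct τ A (suc e) =
    applyEntrywise (λ x → iterate τ x e) A · twistedProduct τ A e

  ColumnSpace : ∀ {k l} → Matrix k l → Pred (Vector Carrier k) (c ⊔ ℓ)
  ColumnSpace {l = l} A y = Σ[ x ∈ Vector Carrier l ] (∀ i → y i ≈ sum (λ j → A i j * x j))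

  HasRank : ∀ {k l} → Matrix k l → ℕ → Set (c ⊔ ℓ)
  HasRank {k} A = Dimension.HasDimension K (coordinateSpace k) (ColumnSpace A)

-- K plays the role of the field with q ^ (n * t) elements.
module Linearized (K : CommutativeRing c ℓ) (q n t u : ℕ) .{{_ : NonZero t}} where
  open CommutativeRing K
  open Sum +-commutativeMonoid using (sum)
  open Exp semiring using (_^_)
  open Matrices K

  σ : Carrier → Carrier
  σ x = x ^ (q ℕ.^ u)

  IsInverseOfσ : (Carrier → Carrier) → Set (c ⊔ ℓ)
  IsInverseOfσ τ = Inverseᵇ _≈_ _≈_ σ τ

  IsExponentOf : (Carrier → Carrier) → Pred ℕ (c ⊔ ℓ)
  IsExponentOf τ s = 1 ≤ s × s ≤ n ℕ.* t × (∀ x → τ x ≈ x ^ (q ℕ.^ s))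

  f : Vector Carrier t → Carrier → Carrier
  f b x = - x + sum (λ i → b i * x ^ (q ℕ.^ (u ℕ.+ n ℕ.* toℕ i)))

  Ker : Vector Carrier t → Pred Carrier ℓ
  Ker b x = f b x ≈ 0#

  -- The index (j + (t - i)) mod t is j - i modulo t without truncation.
  D : Vector Carrier t → Matrix t t
  D b i j = b ((toℕ j ℕ.+ (t ℕ.∸ toℕ i)) mod t) ^ (q ℕ.^ (n ℕ.* toℕ i))

  J : Matrix t t
  J i j = if does (toℕ j ℕ.≟ suc (toℕ i) % t) then 1# else 0#

{-# OPTIONS --safe #-}
module Submission where

-- Write Fr e for x ↦ x^(q^e) on K.  On K^t consider the semilinear maps
-- Ψ Y = (D Y)^σ and G, the cyclic shift composed with Fr n.  They commute, G^t = 1,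
-- and since τ = Fr s with n t ∣ u + s, applying σ^n to the matrix of the theorem
-- shows that its kernel is W = { Y | Ψ^n Y = G^u Y }.  Choosing α u + β n ≡ 1 mod n t,
-- the map H = Ψ^α G^β is Fr 1-semilinear with H^n = G, H^u = Ψ and H^(n t) = 1 on W.
-- The vectors fixed by H are those fixed by both Ψ and G, and these are exactly the
-- vectors (x^(σ q^(n j)))_j with f(x) = 0.  So the theorem is Galois descent for W:
-- an F_q-basis of the fixed vectors is a K-basis of W.  Descent follows from
--   x = - Σ_c c^(q^(n t) - 2) T(c x),  T = Σ_{i < n t} H^i,  c ranging over K,
-- which holds because Σ_c c^(q^(n t) - 2 + q^i) is -1 for i = 0 and 0 for 0 < i < n t.

open import Defs
open import Algebra.Apartness.Bundles using (HeytingField)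
open import Algebra.Bundles using (CommutativeRing; CommutativeMonoid; CommutativeSemiring)
open import Algebra.Module.Bundles using (LeftModule)
import Algebra.Module.Construct.TensorUnit as TensorUnit
open import Algebra.Morphism.Structures using (IsRingHomomorphism)
import Algebra.Properties.AbelianGroup as AbelianGroupProperties
import Algebra.Properties.CommutativeMonoid.Sum as Sum
import Algebra.Properties.CommutativeSemigroup as CommutativeSemigroupProperties
import Algebra.Properties.CommutativeSemiring.Binomial as Binomial
import Algebra.Properties.CommutativeSemiring.Exp as CommutativeExp
import Algebra.Properties.Ring as RingProperties
import Algebra.Properties.Semiring.Exp as Exp
import Algebra.Properties.Semiring.Mult as Mult
import Algebra.Properties.Semiring.Sum as SemiringSum
open import Data.Bool.Base using (if_then_else_)
open import Data.Fin.Base as Fin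
  using (Fin; zero; suc; toℕ; fromℕ; fromℕ<; inject₁; inject≤; _↑ˡ_; _↑ʳ_; splitAt; finToFun; funToFin)
open import Data.Fin.Permutation as Perm using (Permutation; permutation)
import Data.Fin.Properties as Fin
open import Data.Integer.Base as ℤ using (ℤ)
import Data.Integer.Properties as ℤ
open import Data.Integer.Tactic.RingSolver using () renaming (solve-∀ to ℤ-solve-∀)
open import Data.Nat.Base as ℕ using (ℕ; zero; suc; z≤n; s≤s; _∸_; _!; NonZero)
open import Data.Nat.Combinatorics using (_C_; nCn≡1; nCk≡n!/k![n-k]!; k![n∸k]!∣n!)
open import Data.Nat.Divisibility as ∣ using (_∣_; _∤_; divides; quotient)
open import Data.Nat.DivMod
open import Data.Nat.GCD using (gcd; gcd-GCD; GCD; module Bézout)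
open import Data.Nat.GeneralisedArithmetic using (fold; fold-+; iterate)
open import Data.Nat.Primality
  using (Prime; euclidsLemma; prime⇒nonZero; prime⇒nonTrivial; ¬prime[0]; ¬prime[1])
import Data.Nat.Properties as ℕ
open import Data.Nat.Tactic.RingSolver using (solve-∀)
open import Data.Product.Base using (_×_; _,_; proj₁; proj₂; ∃-syntax; Σ-syntax)
open import Data.Sum.Base using (_⊎_; inj₁; inj₂; [_,_]′)
open import Data.Vec.Functional using (Vector; _∷_; _++_; tail)
open import Function.Base using (_∘_; id)
open import Function.Bundles using (Inverse; _⇔_; mk⇔)
open import Function.Definitions using (Congruent; Injective)
open import Level using (Level; _⊔_)
open import Relation.Binary.Bundles using (Setoid)
open import Relation.Binary.Definitions using (Decidable)
open import Relation.Binary.PropositionalEquality as ≡ using (_≡_; _≢_; _≗_)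
import Relation.Binary.Reasoning.Setoid as SetoidReasoning
open import Relation.Nullary.Decidable using (Dec; yes; no; map′; does; decidable-stable)
open import Relation.Nullary.Negation using (¬_; contradiction)
open import Relation.Unary using (Pred)

-- `D` may be singular, even zero, so `Ψ` need not be invertible on K^t. Only on W, where Ψ^n = G^u
-- and G is invertible, do both maps become powers of one periodic map. This is why α and β are
-- taken as natural numbers and why periodicity is proved vector by vector. The congruence α u + β n
-- ≡ 1 does two jobs: on scalars it makes H act through Fr 1, and on vectors of W it identifies H^n
-- and H^u. The exponent q^(n t) - 2 comes from inversion: for c ≠ 0 the power is 1/c, so the
-- formula averages T(c x)/c over c and the coefficient of H^i x is a sum of c^(q^i - 1), a
-- nontrivial character for 0 < i < n t. The identity plays the part of Dedekind's independence of
-- characters. On W it exhibits each vector as a combination of fixed ones, and on K itself it says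
-- that the trace form is nondegenerate, which turns independence over the subfield into
-- independence over K. All choices (inverses, bases, membership in spans) are made by searching
-- finite sets.

private
  variable
    c c′ ℓ ℓ₁ ℓ₂ ℓ₁′ ℓ₂′ m ℓm p : Level

-- Finite fields

module _ (M : CommutativeMonoid c ℓ) where
  open CommutativeMonoid M
  open Sum M

  sum-single : ∀ {k} (g : Vector Carrier k) i → (∀ j → j ≢ i → g j ≈ ε) → sum g ≈ g i
  sum-single {suc k} g zero    g≈ε =
    trans (∙-congˡ (trans (sum-cong-≋ λ j → g≈ε (suc j) λ ()) (sum-replicate-zero k)))
          (identityʳ _)
  sum-single g (suc i) g≈ε =
    trans (∙-congʳ (g≈ε zero λ ()))
          (trans (identityˡ _) (sum-single (g ∘ suc) i λ j j≢i → g≈ε (suc j) (j≢i ∘ Fin.suc-injective)))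

-- Binomial coefficients modulo a prime

module _ {p : ℕ} (prime-p : Prime p) where

  prime∤! : ∀ k → k ℕ.< p → p ∤ k !
  prime∤! zero    _   p∣1 with ≡.refl ← ∣.∣1⇒≡1 p∣1 = ¬prime[1] prime-p
  prime∤! (suc k) k<p p∣k! with euclidsLemma (suc k) (k !) prime-p p∣k!
  ... | inj₁ p∣1+k = ∣.>⇒∤ k<p p∣1+k
  ... | inj₂ p∣k   = prime∤! k (ℕ.<-trans (ℕ.n<1+n k) k<p) p∣k

  -- `p` divides `p !`, which is the binomial coefficient times `k ! * (p ∸ k) !`, and it divides
  -- neither of these two factorials.
  prime∣binomial : ∀ k → 0 ℕ.< k → k ℕ.< p → p ∣ p C k
  prime∣binomial k 0<k k<p with euclidsLemma (p C k) (k ! ℕ.* (p ∸ k) !) prime-p p∣C*k![p∸k]!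
    where
    instance
      _ = prime⇒nonZero prime-p
      _ = k ℕ.!* (p ∸ k) !≢0

    p!≡ : (p C k) ℕ.* (k ! ℕ.* (p ∸ k) !) ≡ p !
    p!≡ = ≡.trans (≡.cong (ℕ._* (k ! ℕ.* (p ∸ k) !)) (nCk≡n!/k![n-k]! (ℕ.<⇒≤ k<p)))
                  (m/n*n≡m (k![n∸k]!∣n! (ℕ.<⇒≤ k<p)))

    p∣p! : ∀ n → .{{ℕ.NonZero n}} → n ∣ n !
    p∣p! (suc n) = ∣.m∣m*n (n !)

    p∣C*k![p∸k]! : p ∣ (p C k) ℕ.* (k ! ℕ.* (p ∸ k) !)
    p∣C*k![p∸k]! = ≡.subst (p ∣_) (≡.sym p!≡) (p∣p! p)
  ... | inj₁ p∣C = p∣C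
  ... | inj₂ p∣k![p∸k]! with euclidsLemma (k !) ((p ∸ k) !) prime-p p∣k![p∸k]!
  ...   | inj₁ p∣k! = contradiction p∣k! (prime∤! k k<p)
  ...   | inj₂ p∣[p∸k]! = contradiction p∣[p∸k]!
    (prime∤! (p ∸ k) (ℕ.∸-monoʳ-< 0<k (ℕ.<⇒≤ k<p)))

  module _ (S : CommutativeSemiring c ℓ) where
    open CommutativeSemiring S hiding (zero)
    open Exp semiring
    open Mult semiring using (×-congʳ; ×-congˡ; ×-homo-1; ×-assocˡ; ×-assoc-*) renaming (_×_ to _×′_)
    open Sum +-commutativeMonoid
    open SetoidReasoning setoid

    -- Each binomial term strictly between the two ends has a coefficient divisible by `p`, hence
    -- vanishes.
    freshman : p ×′ 1# ≈ 0# → ∀ x y → (x + y) ^ p ≈ x ^ p + y ^ p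
    freshman p≈0 x y = expand p ≡.refl
      where
      module B = Binomial S
      multiple≈0 : ∀ m z → p ∣ m → m ×′ z ≈ 0#
      multiple≈0 m z (divides k m≡k*p) = begin
        m ×′ z                ≈⟨ ×-congˡ (≡.trans m≡k*p (ℕ.*-comm k p)) ⟩
        (p ℕ.* k) ×′ z        ≈⟨ ×-assocˡ z p k ⟨
        p ×′ (k ×′ z)         ≈⟨ ×-congʳ p (*-identityˡ _) ⟨
        p ×′ (1# * (k ×′ z))  ≈⟨ ×-assoc-* p 1# (k ×′ z) ⟨
        (p ×′ 1#) * (k ×′ z)  ≈⟨ *-congʳ p≈0 ⟩
        0# * (k ×′ z)         ≈⟨ zeroˡ _ ⟩
        0#                    ∎

      -- Matching `m` against `p` exposes the exponent as a successor, so that both end terms can be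
      -- split off the expansion.
      expand : ∀ m → m ≡ p → (x + y) ^ m ≈ x ^ m + y ^ m
      expand zero    ≡.refl = contradiction prime-p ¬prime[0]
      expand (suc m) ≡.refl = begin
        (x + y) ^ suc m                             ≈⟨ B.theorem (suc m) x y ⟩
        term zero + sum (term ∘ suc)                ≈⟨ +-congˡ (sum-init-last (term ∘ suc)) ⟩
        term zero + (sum middle + term (fromℕ (suc m)))
          ≈⟨ +-cong first (+-cong (trans (sum-cong-≋ middle≈0) (sum-replicate-zero m)) final) ⟩
        y ^ suc m + (0# + x ^ suc m)                ≈⟨ +-congˡ (+-identityˡ _) ⟩
        y ^ suc m + x ^ suc m                       ≈⟨ +-comm _ _ ⟩
        x ^ suc m + y ^ suc m                       ∎
        where
        term = B.binomialTerm x y (suc m)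
        middle = λ i → term (suc (inject₁ i))

        first : term zero ≈ y ^ suc m
        first = trans (×-homo-1 _) (*-identityˡ _)

        final : term (fromℕ (suc m)) ≈ x ^ suc m
        final = begin
          (suc m C k) ×′ (x ^ k * y ^ (suc m ∸ k))
            ≡⟨ ≡.cong (λ k → (suc m C k) ×′ (x ^ k * y ^ (suc m ∸ k))) (Fin.toℕ-fromℕ (suc m)) ⟩
          (suc m C suc m) ×′ (x ^ suc m * y ^ (m ∸ m))
            ≈⟨ ×-congˡ (nCn≡1 (suc m)) ⟩
          1 ×′ (x ^ suc m * y ^ (m ∸ m))  ≈⟨ ×-homo-1 _ ⟩
          x ^ suc m * y ^ (m ∸ m)         ≡⟨ ≡.cong (λ k → x ^ suc m * y ^ k) (ℕ.n∸n≡0 m) ⟩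
          x ^ suc m * 1#                  ≈⟨ *-identityʳ _ ⟩
          x ^ suc m                       ∎
          where k = toℕ (fromℕ (suc m))

        middle≈0 : ∀ i → middle i ≈ 0#
        middle≈0 i = multiple≈0 _ _ (prime∣binomial (suc (toℕ (inject₁ i))) (s≤s z≤n)
          (s≤s (≡.subst (ℕ._< m) (≡.sym (Fin.toℕ-inject₁ i)) (Fin.toℕ<n i))))

-- Roots of monic polynomials

module Polynomials (R : CommutativeRing c ℓ) where
  open CommutativeRing R hiding (zero)
  open Exp semiring
  open RingProperties ring
  open CommutativeSemigroupProperties *-commutativeSemigroup using (x∙yz≈y∙xz)
  open SetoidReasoning setoid

  -- The functions induced by monic polynomials of degree d, in Horner form.
  Monic : ℕ → (Carrier → Carrier) → Set (c ⊔ ℓ)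
  Monic zero    g = ∀ x → g x ≈ 1#
  Monic (suc d) g = ∃[ g′ ] ∃[ r ] (Monic d g′ × (∀ x → g x ≈ x * g′ x + r))

  monic-^ : ∀ d → Monic d (_^ d)
  monic-^ zero    = λ _ → refl
  monic-^ (suc d) = _ , 0# , monic-^ d , λ x → sym (+-identityʳ _)

  -- x^(d+2) - x = x (x * x^d + (-1)) + 0
  monic-^- : ∀ d → Monic (2 ℕ.+ d) (λ x → x ^ (2 ℕ.+ d) - x)
  monic-^- d = (λ x → x * x ^ d + - 1#) , 0# , (_ , _ , monic-^ d , λ _ → refl) , λ x → sym (begin
    x * (x * x ^ d + - 1#) + 0#     ≈⟨ +-identityʳ _ ⟩
    x * (x * x ^ d + - 1#)          ≈⟨ distribˡ _ _ _ ⟩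
    x * (x * x ^ d) + x * - 1#      ≈⟨ +-congˡ (-‿distribʳ-* x 1#) ⟨
    x * (x * x ^ d) + - (x * 1#)    ≈⟨ +-congˡ (-‿cong (*-identityʳ x)) ⟩
    x * (x * x ^ d) + - x           ∎)

  -- Ruffini's rule along the Horner form: a quotient `h` and remainder `r′` of the inner polynomial
  -- become the quotient `x * h x + r′` and the remainder `a * r′ + r`.
  divide : ∀ d {g} → Monic (suc d) g → ∀ a →
           ∃[ h ] ∃[ r ] (Monic d h × (∀ x → g x ≈ (x - a) * h x + r))
  divide zero    {g} (g′ , r , g′≈1 , eq) a = (λ _ → 1#) , a + r , (λ _ → refl) , λ x → begin
    g x                     ≈⟨ eq x ⟩
    x * g′ x + r            ≈⟨ +-congʳ (trans (*-congˡ (g′≈1 x)) (*-identityʳ x)) ⟩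
    x + r                   ≈⟨ +-congʳ (+-identityʳ x) ⟨
    (x + 0#) + r            ≈⟨ +-congʳ (+-congˡ (-‿inverseˡ a)) ⟨
    (x + (- a + a)) + r     ≈⟨ +-congʳ (+-assoc _ _ _) ⟨
    ((x - a) + a) + r       ≈⟨ +-assoc _ _ _ ⟩
    (x - a) + (a + r)       ≈⟨ +-congʳ (*-identityʳ _) ⟨
    (x - a) * 1# + (a + r)  ∎
  divide (suc d) {g} (g′ , r , monic , eq) a with divide d monic a
  ... | h , r′ , monic-h , eq′ =
    (λ x → x * h x + r′) , a * r′ + r , (h , r′ , monic-h , λ _ → refl) , λ x → begin
    g x                                               ≈⟨ eq x ⟩
    x * g′ x + r                                      ≈⟨ +-congʳ (*-congˡ (eq′ x)) ⟩
    x * ((x - a) * h x + r′) + r                      ≈⟨ +-congʳ (distribˡ _ _ _) ⟩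
    (x * ((x - a) * h x) + x * r′) + r
      ≈⟨ +-congʳ (+-cong (x∙yz≈y∙xz x (x - a) (h x)) (split x r′)) ⟩
    ((x - a) * (x * h x) + ((x - a) * r′ + a * r′)) + r ≈⟨ +-congʳ (+-assoc _ _ _) ⟨
    (((x - a) * (x * h x) + (x - a) * r′) + a * r′) + r ≈⟨ +-congʳ (+-congʳ (distribˡ _ _ _)) ⟨
    ((x - a) * (x * h x + r′) + a * r′) + r           ≈⟨ +-assoc _ _ _ ⟩
    (x - a) * (x * h x + r′) + (a * r′ + r)           ∎
    where
    split : ∀ x z → x * z ≈ (x - a) * z + a * z
    split x z = begin
      x * z                  ≈⟨ *-congʳ (+-identityʳ x) ⟨
      (x + 0#) * z           ≈⟨ *-congʳ (+-congˡ (-‿inverseˡ a)) ⟨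
      (x + (- a + a)) * z    ≈⟨ *-congʳ (+-assoc _ _ _) ⟨
      ((x - a) + a) * z      ≈⟨ distribʳ _ _ _ ⟩
      (x - a) * z + a * z    ∎

  factor : ∀ d {g} → Monic (suc d) g → ∀ a → g a ≈ 0# →
           ∃[ h ] (Monic d h × (∀ x → g x ≈ (x - a) * h x))
  factor d {g} monic a ga≈0 with divide d monic a
  ... | h , r , monic-h , eq = h , monic-h , λ x →
    trans (eq x) (trans (+-congˡ r≈0) (+-identityʳ _))
    where
    r≈0 : r ≈ 0#
    r≈0 = begin
      r                  ≈⟨ +-identityˡ r ⟨
      0# + r             ≈⟨ +-congʳ (zeroˡ (h a)) ⟨
      0# * h a + r       ≈⟨ +-congʳ (*-congʳ (-‿inverseʳ a)) ⟨
      (a - a) * h a + r  ≈⟨ eq a ⟨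
      g a                ≈⟨ ga≈0 ⟩
      0#                 ∎

  module _ (integral : ∀ {x y} → x * y ≈ 0# → x ≈ 0# ⊎ y ≈ 0#) (1≉0 : ¬ 1# ≈ 0#) where

    -- Splitting off `x - a zero` lowers the degree, and the other `a i` are roots of the quotient
    -- because they differ from `a zero`. Stating the bound as exhaustion yields the index of the
    -- root, which later serves as a preimage in the subfield and as the value of an injection
    -- between finite sets.
    roots-exhaust : ∀ d {g} → Monic d g → (a : Vector Carrier d) → Injective _≡_ _≈_ a →
                    (∀ i → g (a i) ≈ 0#) → ∀ x → g x ≈ 0# → ∃[ i ] x ≈ a i
    roots-exhaust zero    g≈1   a inj roots x gx≈0 = contradiction (trans (sym (g≈1 x)) gx≈0) 1≉0
    roots-exhaust (suc d) monic a inj roots x gx≈0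
      with factor d monic (a zero) (roots zero)
    ... | h , monic-h , eq with integral (trans (sym (eq x)) gx≈0)
    ... | inj₁ x-a≈0 = zero , x∙y⁻¹≈ε⇒x≈y x (a zero) x-a≈0
    ... | inj₂ hx≈0 = let i , x≈a = roots-exhaust d monic-h (a ∘ suc) (Fin.suc-injective ∘ inj) roots-h x hx≈0
                      in suc i , x≈a
      where
      roots-h : ∀ i → h (a (suc i)) ≈ 0#
      roots-h i with integral (trans (sym (eq (a (suc i)))) (roots (suc i)))
      ... | inj₁ a-a₀≈0 = contradiction (inj (x∙y⁻¹≈ε⇒x≈y _ _ a-a₀≈0)) λ ()
      ... | inj₂ h≈0 = h≈0

-- Arithmetic and power sums of a finite field

module FiniteField (𝕂 : HeytingField c ℓ₁ ℓ₂) {N : ℕ} (order : HasOrder (fieldRing 𝕂) N) where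
  private module 𝕂 = HeytingField 𝕂
  private
    K : CommutativeRing c ℓ₁
    K = fieldRing 𝕂
  open CommutativeRing K hiding (zero)
  open Exp semiring
  open RingProperties ring
  open Polynomials K
  open SetoidReasoning setoid
  open Inverse order
    renaming (to to index; from to element; to-cong to index-cong; from-cong to element-cong;
              strictlyInverseˡ to index-element; strictlyInverseʳ to element-index) public

  infix 4 _≈?_
  _≈?_ : ∀ x y → Dec (x ≈ y)
  x ≈? y = map′ (λ eq → trans (sym (element-index x)) (trans (element-cong eq) (element-index y)))
                index-cong (index x Fin.≟ index y)

  element-injective : Injective _≡_ _≈_ element
  element-injective {i} {j} eq = ≡.trans (≡.sym (index-element i)) (≡.trans (index-cong eq) (index-element j))

  1≉0 : ¬ 1# ≈ 0#
  1≉0 1≈0 = 𝕂.#-irrefl 1≈0 (𝕂.invertible⇒# (1# , inv , trans (*-comm _ _) inv))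
    where
    inv : 1# * (1# - 0#) ≈ 1#
    inv = trans (*-identityˡ _) (trans (+-congˡ -0#≈0#) (+-identityʳ 1#))

  -- A refutation of `x ≈ 0#` does not by itself give apartness, so the inverse is sought among the
  -- finitely many elements. If the search fails, `x` is not apart from `0#`, and tightness gives
  -- `x ≈ 0#`.
  inverse-of : ∀ {x} → ¬ x ≈ 0# → ∃[ y ] x * y ≈ 1#
  inverse-of {x} x≉0 with Fin.any? (λ i → x * element i ≈? 1#)
  ... | yes (i , eq) = element i , eq
  ... | no none = contradiction (proj₁ (𝕂.tight x 0#) not-apart) x≉0
    where
    not-apart : ¬ (x 𝕂.# 0#)
    not-apart x#0 with 𝕂.#⇒invertible x#0
    ... | y , _ , [x-0]*y≈1 = none (index y , (begin
      x * element (index y)  ≈⟨ *-cong (sym (trans (+-congˡ -0#≈0#) (+-identityʳ x))) (element-index y) ⟩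
      (x - 0#) * y           ≈⟨ [x-0]*y≈1 ⟩
      1#                     ∎))

  *-cancelˡ-≉0 : ∀ {x y z} → ¬ x ≈ 0# → x * y ≈ x * z → y ≈ z
  *-cancelˡ-≉0 {x} {y} {z} x≉0 eq with inverse-of x≉0
  ... | x⁻¹ , inv = trans (sym (undo y)) (trans (*-congˡ eq) (undo z))
    where
    undo : ∀ w → x⁻¹ * (x * w) ≈ w
    undo w = trans (sym (*-assoc _ _ _)) (trans (*-congʳ (trans (*-comm _ _) inv)) (*-identityˡ w))

  integral : ∀ {x y} → x * y ≈ 0# → x ≈ 0# ⊎ y ≈ 0#
  integral {x} {y} xy≈0 with x ≈? 0#
  ... | yes x≈0 = inj₁ x≈0
  ... | no x≉0 = inj₂ (*-cancelˡ-≉0 x≉0 (trans xy≈0 (sym (zeroʳ x))))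

  1<order : 1 ℕ.< N
  1<order = Fin.injective⇒≤ {f = 01-index} inj
    where
    01-index : Fin 2 → Fin N
    01-index zero       = index 0#
    01-index (suc zero) = index 1#

    0≢1 : index 0# ≢ index 1#
    0≢1 eq = 1≉0 (sym (trans (sym (element-index 0#)) (trans (element-cong eq) (element-index 1#))))

    inj : Injective _≡_ _≡_ 01-index
    inj {zero}     {zero}     _  = ≡.refl
    inj {zero}     {suc zero} eq = contradiction eq 0≢1
    inj {suc zero} {zero}     eq = contradiction (≡.sym eq) 0≢1
    inj {suc zero} {suc zero} _  = ≡.refl

  module _ (M : CommutativeMonoid m ℓm) where
    private module M = CommutativeMonoid M
    open Sum M

    -- The monoid is arbitrary because the reindexing is applied both to sums and to products over
    -- the field.
    sum-bijection : ∀ (φ ψ : Carrier → Carrier) → Congruent _≈_ _≈_ φ → Congruent _≈_ _≈_ ψ →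
                    (∀ x → φ (ψ x) ≈ x) → (∀ x → ψ (φ x) ≈ x) →
                    (g : Carrier → M.Carrier) → Congruent _≈_ M._≈_ g →
                    sum (g ∘ element) M.≈ sum (g ∘ φ ∘ element)
    sum-bijection φ ψ φ-cong ψ-cong φψ ψφ g g-cong =
      M.trans (sum-permute (g ∘ element) π) (sum-cong-≋ {N} λ i → g-cong (element-index _))
      where
      lift : (Carrier → Carrier) → Fin N → Fin N
      lift χ = index ∘ χ ∘ element

      lift-inverse : ∀ χ ω → Congruent _≈_ _≈_ χ → (∀ x → χ (ω x) ≈ x) → ∀ i → lift χ (lift ω i) ≡ i
      lift-inverse χ ω χ-cong χω i =
        ≡.trans (index-cong (trans (χ-cong (element-index _)) (χω _))) (index-element i)

      π = permutation (lift φ) (lift ψ) (lift-inverse φ ψ φ-cong φψ) (lift-inverse ψ φ ψ-cong ψφ)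

    sum-scaled : ∀ {a} → ¬ a ≈ 0# → (g : Carrier → M.Carrier) → Congruent _≈_ M._≈_ g →
                 sum (g ∘ element) M.≈ sum (λ i → g (a * element i))
    sum-scaled {a} a≉0 g g-cong with inverse-of a≉0
    ... | a⁻¹ , inv = sum-bijection (a *_) (a⁻¹ *_) *-congˡ *-congˡ (cancel inv)
                                    (cancel (trans (*-comm _ _) inv)) g g-cong
      where
      cancel : ∀ {y z} → y * z ≈ 1# → ∀ x → y * (z * x) ≈ x
      cancel eq x = trans (sym (*-assoc _ _ _)) (trans (*-congʳ eq) (*-identityˡ x))

  open Sum +-commutativeMonoid using (sum; sum-cong-≋; ∑-distrib-+; sum-replicate; sum-replicate-zero)
  open SemiringSum semiring using (*-distribˡ-sum)
  open Mult semiring using (×1-homo-*; ×-homo-1) renaming (_×_ to _×′_)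
  open CommutativeExp commutativeSemiring using (^-distrib-*)

  -- Translation by `1#` permutes the field, so the total of all elements equals itself plus
  -- `N ×′ 1#`.
  order×1≈0 : N ×′ 1# ≈ 0#
  order×1≈0 = +-identityˡ-unique (N ×′ 1#) total (sym (begin
    total
      ≈⟨ sum-bijection +-commutativeMonoid (1# +_) (- 1# +_) +-congˡ +-congˡ
           (cancel (-‿inverseʳ 1#)) (cancel (-‿inverseˡ 1#)) id id ⟩
    sum (λ i → 1# + element i)    ≈⟨ ∑-distrib-+ (λ _ → 1#) element ⟩
    sum {N} (λ _ → 1#) + total    ≈⟨ +-congʳ (sum-replicate N) ⟩
    N ×′ 1# + total               ∎))
    where
    total = sum element
    cancel : ∀ {y z} → y + z ≈ 0# → ∀ x → y + (z + x) ≈ x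
    cancel eq x = trans (sym (+-assoc _ _ _)) (trans (+-congʳ eq) (+-identityˡ x))

  -- Since `p ^ e` kills `1#` and there are no zero divisors, one of the factors `p` does.
  characteristic : ∀ {p} e → N ≡ p ℕ.^ e → p ×′ 1# ≈ 0#
  characteristic {p} e N≡p^e = go e (trans (reflexive (≡.cong (_×′ 1#) (≡.sym N≡p^e))) order×1≈0)
    where
    go : ∀ e → (p ℕ.^ e) ×′ 1# ≈ 0# → p ×′ 1# ≈ 0#
    go zero    1≈0 = contradiction (trans (sym (×-homo-1 1#)) 1≈0) 1≉0
    go (suc e) eq  with integral (trans (sym (×1-homo-* p (p ℕ.^ e))) eq)
    ... | inj₁ p≈0 = p≈0
    ... | inj₂ p^e≈0 = go e p^e≈0

  module Π = Sum *-commutativeMonoid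

  0^order : ∀ {M} → 0 ℕ.< M → 0# ^ M ≈ 0#
  0^order {suc M} _ = zeroˡ _

  atZero : Carrier → Carrier → Carrier → Carrier
  atZero y z x with x ≈? 0#
  ... | yes _ = y
  ... | no  _ = z

  atZero-≈0 : ∀ {y z x} → x ≈ 0# → atZero y z x ≈ y
  atZero-≈0 {x = x} x≈0 with x ≈? 0#
  ... | yes _ = refl
  ... | no x≉0 = contradiction x≈0 x≉0

  atZero-≉0 : ∀ {y z x} → ¬ x ≈ 0# → atZero y z x ≈ z
  atZero-≉0 {x = x} x≉0 with x ≈? 0#
  ... | yes x≈0 = contradiction x≈0 x≉0
  ... | no _ = refl

  -- For a ≠ 0 let P be the product of all nonzero elements.  Scaling the
  -- elements by a permutes them; the factor at zero is never scaled, whence the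
  -- correction factor a on one side of P a = a^N P.
  fermat : ∀ a → a ^ N ≈ a
  fermat a with a ≈? 0#
  ... | yes a≈0 = trans (^-congˡ N a≈0) (trans (0^order (ℕ.<-trans (s≤s z≤n) 1<order)) (sym a≈0))
  ... | no a≉0 = *-cancelˡ-≉0 P≉0 (sym (begin
    P * a
      ≈⟨ *-cong (sum-scaled *-commutativeMonoid a≉0 nz nz-cong) (sym correction≈a) ⟩
    Π.sum (λ i → nz (a * element i)) * Π.sum (correction ∘ element)
      ≈⟨ Π.∑-distrib-+ _ (correction ∘ element) ⟨
    Π.sum (λ i → nz (a * element i) * correction (element i))
      ≈⟨ Π.sum-cong-≋ (λ i → scaled (element i)) ⟩
    Π.sum (λ i → a * nz (element i))  ≈⟨ Π.∑-distrib-+ {N} (λ _ → a) (nz ∘ element) ⟩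
    Π.sum {N} (λ _ → a) * P           ≈⟨ *-congʳ (Π.sum-replicate N) ⟩
    a ^ N * P                         ≈⟨ *-comm _ _ ⟩
    P * a ^ N                         ∎))
    where
    nz correction : Carrier → Carrier
    nz x = atZero 1# x x
    correction = atZero a 1#

    nz-cong : Congruent _≈_ _≈_ nz
    nz-cong {x} {y} x≈y = case (x ≈? 0#)
      where
      case : Dec (x ≈ 0#) → nz x ≈ nz y
      case (yes x≈0) = trans (atZero-≈0 x≈0) (sym (atZero-≈0 (trans (sym x≈y) x≈0)))
      case (no x≉0)  = trans (atZero-≉0 x≉0) (trans x≈y (sym (atZero-≉0 (x≉0 ∘ trans x≈y))))

    P = Π.sum (nz ∘ element)

    correction≈a : Π.sum (correction ∘ element) ≈ a
    correction≈a = trans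
      (sum-single *-commutativeMonoid _ (index 0#) λ j j≢0 → atZero-≉0 λ eq →
         j≢0 (≡.trans (≡.sym (index-element j)) (index-cong eq)))
      (atZero-≈0 (element-index 0#))

    product≉0 : ∀ {k} (g : Vector Carrier k) → (∀ i → ¬ g i ≈ 0#) → ¬ Π.sum g ≈ 0#
    product≉0 {zero}  g g≉0 eq = 1≉0 eq
    product≉0 {suc k} g g≉0 eq = [ g≉0 zero , product≉0 (g ∘ suc) (g≉0 ∘ suc) ]′ (integral eq)

    nz≉0 : ∀ x → ¬ nz x ≈ 0#
    nz≉0 x with x ≈? 0#
    ... | yes _ = 1≉0
    ... | no x≉0 = x≉0

    P≉0 : ¬ P ≈ 0#
    P≉0 = product≉0 _ (nz≉0 ∘ element)

    scaled : ∀ x → nz (a * x) * correction x ≈ a * nz x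
    scaled x = case (x ≈? 0#)
      where
      case : Dec (x ≈ 0#) → nz (a * x) * correction x ≈ a * nz x
      case (yes x≈0) = begin
        nz (a * x) * correction x
          ≈⟨ *-cong (atZero-≈0 (trans (*-congˡ x≈0) (zeroʳ a))) (atZero-≈0 x≈0) ⟩
        1# * a    ≈⟨ *-comm _ _ ⟩
        a * 1#    ≈⟨ *-congˡ (atZero-≈0 x≈0) ⟨
        a * nz x  ∎
      case (no x≉0) = begin
        nz (a * x) * correction x
          ≈⟨ *-cong (atZero-≉0 ([ a≉0 , x≉0 ]′ ∘ integral)) (atZero-≉0 x≉0) ⟩
        a * x * 1#  ≈⟨ *-identityʳ _ ⟩
        a * x       ≈⟨ *-congˡ (atZero-≉0 x≉0) ⟨
        a * nz x    ∎

  -- With 2 + M = N the summand x^M x^k at x ≠ 0 is x^(k-1).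
  module PowerSums (M : ℕ) (2+M≡N : 2 ℕ.+ M ≡ N) where

    powerSum : ℕ → Carrier
    powerSum k = sum (λ i → element i ^ M * element i ^ k)

    private
      fermat′ : ∀ a → a * (a * a ^ M) ≈ a
      fermat′ a = trans (^-congʳ a 2+M≡N) (fermat a)

      [N-1]-power : ∀ {a} → ¬ a ≈ 0# → a ^ M * a ^ 1 ≈ 1#
      [N-1]-power {a} a≉0 = *-cancelˡ-≉0 a≉0 (begin
        a * (a ^ M * (a * 1#))  ≈⟨ *-congˡ (trans (*-congˡ (*-identityʳ a)) (*-comm _ _)) ⟩
        a * (a * a ^ M)         ≈⟨ fermat′ a ⟩
        a                       ≈⟨ *-identityʳ a ⟨
        a * 1#                  ∎)

    -- The summand is `1#` at every nonzero element and `0#` at zero; adding a spike at zero makes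
    -- it constant, and `N` copies of `1#` sum to zero.
    powerSum-1 : powerSum 1 + 1# ≈ 0#
    powerSum-1 = begin
      powerSum 1 + 1#          ≈⟨ +-congˡ spike≈1 ⟨
      powerSum 1 + sum spike   ≈⟨ ∑-distrib-+ _ spike ⟨
      sum (λ i → element i ^ M * element i ^ 1 + spike i)  ≈⟨ sum-cong-≋ (λ i → summand (element i)) ⟩
      sum {N} (λ _ → 1#)       ≈⟨ sum-replicate N ⟩
      N ×′ 1#                  ≈⟨ order×1≈0 ⟩
      0#                       ∎
      where
      spike : Vector Carrier N
      spike i = atZero 1# 0# (element i)

      spike≈1 : sum spike ≈ 1#
      spike≈1 = trans
        (sum-single +-commutativeMonoid _ (index 0#) λ j j≢0 → atZero-≉0 λ eq →
           j≢0 (≡.trans (≡.sym (index-element j)) (index-cong eq)))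
        (atZero-≈0 (element-index 0#))

      summand : ∀ x → x ^ M * x ^ 1 + atZero 1# 0# x ≈ 1#
      summand x = case (x ≈? 0#)
        where
        case : Dec (x ≈ 0#) → x ^ M * x ^ 1 + atZero 1# 0# x ≈ 1#
        case (yes x≈0) = trans
          (+-cong (trans (*-congˡ (trans (*-identityʳ x) x≈0)) (zeroʳ _)) (atZero-≈0 x≈0))
          (+-identityˡ 1#)
        case (no x≉0) = trans (+-cong ([N-1]-power x≉0) (atZero-≉0 x≉0)) (+-identityʳ 1#)

    -- Scaling by g multiplies the sum by g^(k-1) ≠ 1.
    powerSum-≈0 : ∀ k g → ¬ g ^ k ≈ g → ¬ g ≈ 0# → powerSum k ≈ 0#
    powerSum-≈0 k g g^k≉g g≉0 with powerSum k ≈? 0#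
    ... | yes S≈0 = S≈0
    ... | no S≉0 = contradiction g^k≈g g^k≉g
      where
      factor-≈1 : g ^ M * g ^ k ≈ 1#
      factor-≈1 = *-cancelˡ-≉0 S≉0 (begin
        powerSum k * (g ^ M * g ^ k)                            ≈⟨ *-comm _ _ ⟩
        (g ^ M * g ^ k) * powerSum k                            ≈⟨ *-distribˡ-sum _ (λ i → element i ^ M * element i ^ k) ⟩
        sum (λ i → (g ^ M * g ^ k) * (element i ^ M * element i ^ k))
          ≈⟨ sum-cong-≋ (λ i → trans (*-cong (^-distrib-* g (element i) M) (^-distrib-* g (element i) k))
                                     (interchange _ _ _ _)) ⟨
        sum (λ i → (g * element i) ^ M * (g * element i) ^ k)
          ≈⟨ sum-scaled +-commutativeMonoid g≉0 (λ x → x ^ M * x ^ k) (λ eq → *-cong (^-congˡ M eq) (^-congˡ k eq)) ⟨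
        powerSum k       ≈⟨ *-identityʳ _ ⟨
        powerSum k * 1#  ∎)
        where open CommutativeSemigroupProperties *-commutativeSemigroup using (interchange)

      g^k≈g : g ^ k ≈ g
      g^k≈g = *-cancelˡ-≉0 g≉0 (sym (begin
        g * g                        ≈⟨ *-congˡ (*-identityʳ g) ⟨
        g * (g * 1#)                 ≈⟨ *-congˡ (*-congˡ factor-≈1) ⟨
        g * (g * (g ^ M * g ^ k))    ≈⟨ *-congˡ (*-assoc _ _ _) ⟨
        g * ((g * g ^ M) * g ^ k)    ≈⟨ *-assoc _ _ _ ⟨
        g * (g * g ^ M) * g ^ k      ≈⟨ *-congʳ (fermat′ g) ⟩
        g * g ^ k                    ∎))

-- Linear algebra over a finite field

module Combinations (R : CommutativeRing c ℓ) (V : LeftModule (CommutativeRing.ring R) m ℓm) where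
  open CommutativeRing R hiding (zero)
  open LeftModule V
  open Dimension R V
  open Sum +ᴹ-commutativeMonoid
  open Sum +-commutativeMonoid using () renaming (sum to ∑)
  open AbelianGroupProperties +ᴹ-abelianGroup using (inverseʳ-unique)
  open SetoidReasoning ≈ᴹ-setoid

  -ᴹ≈-1*ₗ : ∀ x → -ᴹ x ≈ᴹ - 1# *ₗ x
  -ᴹ≈-1*ₗ x = ≈ᴹ-sym (inverseʳ-unique x (- 1# *ₗ x) (begin
    x +ᴹ - 1# *ₗ x        ≈⟨ +ᴹ-congʳ (*ₗ-identityˡ x) ⟨
    1# *ₗ x +ᴹ - 1# *ₗ x  ≈⟨ *ₗ-distribʳ x 1# (- 1#) ⟨
    (1# - 1#) *ₗ x        ≈⟨ *ₗ-congʳ (-‿inverseʳ 1#) ⟩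
    0# *ₗ x               ≈⟨ *ₗ-zeroˡ x ⟩
    0ᴹ                    ∎))

  *ₗ-distribˡ-sum : ∀ {k} α (x : Vector Carrierᴹ k) → α *ₗ sum x ≈ᴹ sum (λ i → α *ₗ x i)
  *ₗ-distribˡ-sum {zero}  α x = *ₗ-zeroʳ α
  *ₗ-distribˡ-sum {suc k} α x = ≈ᴹ-trans (*ₗ-distribˡ α _ _) (+ᴹ-congˡ (*ₗ-distribˡ-sum α (tail x)))

  *ₗ-distribʳ-sum : ∀ {k} (α : Vector Carrier k) x → ∑ α *ₗ x ≈ᴹ sum (λ i → α i *ₗ x)
  *ₗ-distribʳ-sum {zero}  α x = *ₗ-zeroˡ x
  *ₗ-distribʳ-sum {suc k} α x = ≈ᴹ-trans (*ₗ-distribʳ x _ _) (+ᴹ-congˡ (*ₗ-distribʳ-sum (tail α) x))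

  sum-++ : ∀ d {e} (x : Vector Carrierᴹ (d ℕ.+ e)) →
           sum x ≈ᴹ sum (λ i → x (i ↑ˡ e)) +ᴹ sum (λ j → x (d ↑ʳ j))
  sum-++ zero    x = ≈ᴹ-sym (+ᴹ-identityˡ _)
  sum-++ (suc d) x = ≈ᴹ-trans (+ᴹ-congˡ (sum-++ d (tail x))) (≈ᴹ-sym (+ᴹ-assoc _ _ _))

  combination-cong : ∀ {k} {α β : Vector Carrier k} {v w} → (∀ i → α i ≈ β i) → (∀ i → v i ≈ᴹ w i) →
                     combination α v ≈ᴹ combination β w
  combination-cong {k} α≈β v≈w = sum-cong-≋ {k} λ i → *ₗ-cong (α≈β i) (v≈w i)

  combination-congʳ : ∀ {k} {α β : Vector Carrier k} {v} → (∀ i → α i ≈ β i) →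
                      combination α v ≈ᴹ combination β v
  combination-congʳ {α = α} {β} α≈β = combination-cong {α = α} {β} α≈β λ _ → ≈ᴹ-refl

  combination-0 : ∀ {k} (v : Vector Carrierᴹ k) → combination (λ _ → 0#) v ≈ᴹ 0ᴹ
  combination-0 {k} v = ≈ᴹ-trans (sum-cong-≋ {k} λ i → *ₗ-zeroˡ (v i)) (sum-replicate-zero k)

  combination-of-0 : ∀ {k} (α : Vector Carrier k) → combination α (λ _ → 0ᴹ) ≈ᴹ 0ᴹ
  combination-of-0 {k} α = ≈ᴹ-trans (sum-cong-≋ {k} λ i → *ₗ-zeroʳ (α i)) (sum-replicate-zero k)

  combination-+ : ∀ {k} (α β : Vector Carrier k) v →
                  combination (λ i → α i + β i) v ≈ᴹ combination α v +ᴹ combination β v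
  combination-+ {k} α β v = ≈ᴹ-trans (sum-cong-≋ {k} λ i → *ₗ-distribʳ (v i) (α i) (β i))
                                     (∑-distrib-+ (λ i → α i *ₗ v i) λ i → β i *ₗ v i)

  combination-* : ∀ {k} a (α : Vector Carrier k) v →
                  combination (λ i → a * α i) v ≈ᴹ a *ₗ combination α v
  combination-* {k} a α v = ≈ᴹ-trans (sum-cong-≋ {k} λ i → *ₗ-assoc a (α i) (v i))
                                     (≈ᴹ-sym (*ₗ-distribˡ-sum a λ i → α i *ₗ v i))

  combination-- : ∀ {k} (α β : Vector Carrier k) v →
                  combination (λ i → α i - β i) v ≈ᴹ combination α v +ᴹ -ᴹ combination β v
  combination-- α β v = ≈ᴹ-trans (combination-+ α (-_ ∘ β) v) (+ᴹ-congˡ (begin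
    combination (λ i → - β i) v         ≈⟨ combination-congʳ {v = v} (λ i → sym (-1*x≈-x (β i))) ⟩
    combination (λ i → - 1# * β i) v    ≈⟨ combination-* (- 1#) β v ⟩
    - 1# *ₗ combination β v             ≈⟨ -ᴹ≈-1*ₗ _ ⟨
    -ᴹ combination β v                  ∎))
    where open RingProperties ring using (-1*x≈-x)

  combination-++ : ∀ {d e} (α : Vector Carrier (d ℕ.+ e)) (v : Vector Carrierᴹ d) (w : Vector Carrierᴹ e) →
                   combination α (v ++ w) ≈ᴹ
                   combination (λ i → α (i ↑ˡ e)) v +ᴹ combination (λ j → α (d ↑ʳ j)) w
  combination-++ {d} {e} α v w = ≈ᴹ-trans (sum-++ d λ i → α i *ₗ (v ++ w) i) (+ᴹ-cong
    (sum-cong-≋ {d} λ i → *ₗ-congˡ (≈ᴹ-reflexive (≡.cong [ v , w ]′ (Fin.splitAt-↑ˡ d i e))))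
    (sum-cong-≋ {e} λ j → *ₗ-congˡ (≈ᴹ-reflexive (≡.cong [ v , w ]′ (Fin.splitAt-↑ʳ d e j)))))

  combination-++-++ : ∀ {d e} (α : Vector Carrier d) (β : Vector Carrier e) v w →
                      combination (α ++ β) (v ++ w) ≈ᴹ combination α v +ᴹ combination β w
  combination-++-++ {d} {e} α β v w = ≈ᴹ-trans (combination-++ (α ++ β) v w) (+ᴹ-cong
    (combination-congʳ {β = α} {v} λ i → reflexive (≡.cong [ α , β ]′ (Fin.splitAt-↑ˡ d i e)))
    (combination-congʳ {β = β} {w} λ j → reflexive (≡.cong [ α , β ]′ (Fin.splitAt-↑ʳ d e j))))

  Span : ∀ {k} → Vector Carrierᴹ k → Pred Carrierᴹ (c ⊔ ℓm)
  Span v x = ∃[ α ] x ≈ᴹ combination α v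

  0∈span : ∀ {k} {v : Vector Carrierᴹ k} → Span v 0ᴹ
  0∈span {v = v} = (λ _ → 0#) , ≈ᴹ-sym (combination-0 v)

  span-resp : ∀ {k} {v : Vector Carrierᴹ k} {x y} → x ≈ᴹ y → Span v x → Span v y
  span-resp x≈y (α , eq) = α , ≈ᴹ-trans (≈ᴹ-sym x≈y) eq

  span-+ : ∀ {k} {v : Vector Carrierᴹ k} {x y} → Span v x → Span v y → Span v (x +ᴹ y)
  span-+ {v = v} (α , eq) (β , eq′) = _ , ≈ᴹ-trans (+ᴹ-cong eq eq′) (≈ᴹ-sym (combination-+ α β v))

  span-* : ∀ {k} {v : Vector Carrierᴹ k} {x} a → Span v x → Span v (a *ₗ x)
  span-* {v = v} a (α , eq) = _ , ≈ᴹ-trans (*ₗ-congˡ eq) (≈ᴹ-sym (combination-* a α v))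

  span-sum : ∀ {k l} {v : Vector Carrierᴹ k} {x : Vector Carrierᴹ l} → (∀ i → Span v (x i)) → Span v (sum x)
  span-sum {l = zero}  x∈span = 0∈span
  span-sum {l = suc l} x∈span = span-+ (x∈span zero) (span-sum (x∈span ∘ suc))

  span-combination : ∀ {k l} {v : Vector Carrierᴹ k} {x : Vector Carrierᴹ l} α →
                     (∀ i → Span v (x i)) → Span v (combination α x)
  span-combination α x∈span = span-sum λ i → span-* (α i) (x∈span i)

module FiniteLinearAlgebra
  (𝔽 : HeytingField c ℓ₁ ℓ₂) {q : ℕ} (order : HasOrder (fieldRing 𝔽) q)
  (V : LeftModule (CommutativeRing.ring (fieldRing 𝔽)) m ℓm)
  where
  open FiniteField 𝔽 order
    using (_≈?_; inverse-of; index; element; index-cong; element-cong; element-index; index-element; 1<order)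
  open CommutativeRing (fieldRing 𝔽) hiding (zero)
  open LeftModule V
  open Dimension (fieldRing 𝔽) V
  open Combinations (fieldRing 𝔽) V
  open RingProperties ring using (x∙y⁻¹≈ε⇒x≈y)
  open AbelianGroupProperties +ᴹ-abelianGroup using (inverseˡ-unique)

  independent-injective : ∀ {k} {v : Vector Carrierᴹ k} → LinearlyIndependent v → ∀ {α β} →
                          combination α v ≈ᴹ combination β v → ∀ i → α i ≈ β i
  independent-injective {v = v} independent {α} {β} eq i = x∙y⁻¹≈ε⇒x≈y _ _ (independent (λ i → α i - β i)
    (≈ᴹ-trans (combination-- α β v) (≈ᴹ-trans (+ᴹ-congʳ eq) (-ᴹ‿inverseʳ _))) i)

  funToFin-cong : ∀ {k l} {g h : Fin k → Fin l} → g ≗ h → funToFin g ≡ funToFin h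
  funToFin-cong {zero}  eq = ≡.refl
  funToFin-cong {suc k} eq = ≡.cong₂ Fin.combine (eq zero) (funToFin-cong (eq ∘ suc))

  decode : ∀ {k} → Fin (q ℕ.^ k) → Vector Carrier k
  decode i = element ∘ finToFun i

  encode : ∀ {k} → Vector Carrier k → Fin (q ℕ.^ k)
  encode α = funToFin (index ∘ α)

  decode-encode : ∀ {k} (α : Vector Carrier k) i → decode (encode α) i ≈ α i
  decode-encode α i = trans (element-cong (Fin.finToFun-funToFin (index ∘ α) i)) (element-index (α i))

  encode-decode : ∀ {k} (i : Fin (q ℕ.^ k)) → encode (decode {k} i) ≡ i
  encode-decode {k} i =
    ≡.trans (funToFin-cong λ j → index-element (finToFun {q} {k} i j)) (Fin.funToFin-finToFin {k} {q} i)

  -- Counting replaces the exchange lemma: the `q ^ k` combinations of `v` are distinct, and each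
  -- has coordinates over `w`, of which there are only `q ^ l`.
  independent≤spanning : ∀ {k l} {v : Vector Carrierᴹ k} {w : Vector Carrierᴹ l} →
                         LinearlyIndependent v → (∀ i → Span w (v i)) → k ℕ.≤ l
  independent≤spanning {k} {l} {v} {w} independent v∈span = ℕ.≮⇒≥ λ l<k →
    ℕ.<⇒≱ (ℕ.^-monoʳ-< q 1<order l<k)
          (Fin.injective⇒≤ {f = encode {l} ∘ coordinates ∘ decode {k}} injective)
    where
    in-span : ∀ α → Span w (combination α v)
    in-span α = span-combination α v∈span

    coordinates : Vector Carrier k → Vector Carrier l
    coordinates α = proj₁ (in-span α)

    injective : Injective _≡_ _≡_ (encode {l} ∘ coordinates ∘ decode {k})
    injective {i} {j} eq = ≡.trans (≡.sym (encode-decode {k} i))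
      (≡.trans (funToFin-cong λ e → index-cong (same e)) (encode-decode {k} j))
      where
      β γ : Vector Carrier l
      β = coordinates (decode {k} i)
      γ = coordinates (decode {k} j)

      β≈γ : ∀ e → β e ≈ γ e
      β≈γ e = trans (sym (decode-encode β e))
        (trans (reflexive (≡.cong (λ z → decode {l} z e) eq)) (decode-encode γ e))

      same : ∀ e → decode {k} i e ≈ decode {k} j e
      same = independent-injective independent (≈ᴹ-trans (proj₂ (in-span (decode {k} i)))
        (≈ᴹ-trans (combination-congʳ {α = β} {γ} {w} β≈γ) (≈ᴹ-sym (proj₂ (in-span (decode {k} j))))))

  module _ (_≈ᴹ?_ : Decidable _≈ᴹ_) where

    -- There are finitely many coefficient vectors to try.
    span? : ∀ {k} (v : Vector Carrierᴹ k) x → Dec (Span v x)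
    span? {k} v x = map′
      (λ (i , eq) → decode {k} i , eq)
      (λ (α , eq) → encode α , ≈ᴹ-trans eq (combination-congʳ {v = v} λ i → sym (decode-encode α i)))
      (Fin.any? λ i → x ≈ᴹ? combination (decode {k} i) v)

    independent-∷ : ∀ {k} {v : Vector Carrierᴹ k} {x} → LinearlyIndependent v → ¬ Span v x →
                    LinearlyIndependent (x ∷ v)
    independent-∷ {v = v} {x} independent x∉span α αxv≈0 = go (α zero ≈? 0#)
      where
      rest = combination (tail α) v

      go : Dec (α zero ≈ 0#) → ∀ i → α i ≈ 0#
      go (yes α₀≈0) zero    = α₀≈0
      go (yes α₀≈0) (suc i) = independent (tail α)
        (≈ᴹ-trans (≈ᴹ-sym (+ᴹ-identityˡ rest))
          (≈ᴹ-trans (+ᴹ-congʳ (≈ᴹ-sym (≈ᴹ-trans (*ₗ-congʳ α₀≈0) (*ₗ-zeroˡ x)))) αxv≈0)) i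
      go (no α₀≉0) = contradiction (span-resp undo (span-* α₀⁻¹ α₀x∈span)) x∉span
        where
        α₀⁻¹ = proj₁ (inverse-of α₀≉0)

        α₀x∈span : Span v (α zero *ₗ x)
        α₀x∈span = span-resp
          (≈ᴹ-sym (≈ᴹ-trans (inverseˡ-unique _ _ αxv≈0) (-ᴹ≈-1*ₗ rest)))
          (span-* (- 1#) (tail α , ≈ᴹ-refl))

        undo : α₀⁻¹ *ₗ (α zero *ₗ x) ≈ᴹ x
        undo = ≈ᴹ-trans (≈ᴹ-sym (*ₗ-assoc _ _ x))
          (≈ᴹ-trans (*ₗ-congʳ (trans (*-comm _ _) (proj₂ (inverse-of α₀≉0)))) (*ₗ-identityˡ x))

    -- A greedy scan keeps a vector only if it lies outside the span of those kept before. `P` is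
    -- carried along so that the basis stays in the subspace under study.
    extract-basis : ∀ (P : Pred Carrierᴹ p) {k} (x : Vector Carrierᴹ k) → (∀ i → P (x i)) →
                    ∃[ d ] Σ[ v ∈ Vector Carrierᴹ d ]
                      ((∀ i → P (v i)) × LinearlyIndependent v × (∀ i → Span v (x i)))
    extract-basis P {zero}  x Px = 0 , (λ ()) , (λ ()) , (λ _ _ ()) , λ ()
    extract-basis P {suc k} x Px with extract-basis P (tail x) (Px ∘ suc)
    ... | d , v , Pv , independent , tail∈span with span? v (x zero)
    ...   | yes x₀∈span = d , v , Pv , independent , λ { zero → x₀∈span ; (suc i) → tail∈span i }
    ...   | no  x₀∉span = suc d , x zero ∷ v , (λ { zero → Px zero ; (suc i) → Pv i }) ,
                          independent-∷ {v = v} independent x₀∉span , λ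
      { zero    → (1# ∷ λ _ → 0#) ,
                  ≈ᴹ-sym (≈ᴹ-trans (+ᴹ-cong (*ₗ-identityˡ _) (combination-0 v)) (+ᴹ-identityʳ _))
      ; (suc i) → let α , eq = tail∈span i in (0# ∷ α) ,
                  ≈ᴹ-trans eq (≈ᴹ-sym (≈ᴹ-trans (+ᴹ-congʳ (*ₗ-zeroˡ _)) (+ᴹ-identityˡ _)))
      }

-- Matrices as linear maps

module MatrixAction (R : CommutativeRing c ℓ) where
  open CommutativeRing R hiding (zero)
  open Matrices R
  open CommutativeSemigroupProperties *-commutativeSemigroup using (x∙yz≈y∙xz)
  open RingProperties ring using (-1*x≈-x)
  open SemiringSum semiring
  open SetoidReasoning setoid

  infixr 7 _⊛_
  _⊛_ : ∀ {k l} → Matrix k l → Vector Carrier l → Vector Carrier k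
  (A ⊛ x) i = sum (λ j → A i j * x j)

  Null : ∀ {k l} → Matrix k l → Pred (Vector Carrier l) ℓ
  Null A x = ∀ i → (A ⊛ x) i ≈ 0#

  sum-coordinate : ∀ {k d} (x : Vector (Vector Carrier k) d) i →
                   Sum.sum (LeftModule.+ᴹ-commutativeMonoid (coordinateSpace k)) x i ≡ sum (λ e → x e i)
  sum-coordinate {d = zero}  x i = ≡.refl
  sum-coordinate {d = suc d} x i = ≡.cong (x zero i +_) (sum-coordinate (tail x) i)

  -- The predicate is abstract so that one argument covers the rows and columns of `identity` as
  -- well as the rows of `J`.
  indicator-sum : ∀ {ℓ k} {P : Fin k → Set ℓ} (P? : ∀ j → Dec (P j)) (Y : Vector Carrier k) j₀ →
                  P j₀ → (∀ j → P j → j ≡ j₀) →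
                  sum (λ j → (if does (P? j) then 1# else 0#) * Y j) ≈ Y j₀
  indicator-sum {P = P} P? Y j₀ Pj₀ unique = trans
    (sum-single +-commutativeMonoid _ j₀ λ j j≢j₀ → off j (P? j) j≢j₀) (on (P? j₀))
    where
    off : ∀ j (d : Dec (P j)) → j ≢ j₀ → (if does d then 1# else 0#) * Y j ≈ 0#
    off j (yes Pj) j≢j₀ = contradiction (unique j Pj) j≢j₀
    off j (no _)   _    = zeroˡ (Y j)
    on : (d : Dec (P j₀)) → (if does d then 1# else 0#) * Y j₀ ≈ Y j₀
    on (yes _)  = *-identityˡ _
    on (no ¬P₀) = contradiction Pj₀ ¬P₀

  identity-⊛ : ∀ {k} Y i → (identity k ⊛ Y) i ≈ Y i
  identity-⊛ Y i = indicator-sum (i Fin.≟_) Y i ≡.refl λ _ → ≡.sym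

  ·-⊛ : ∀ {k l r} (A : Matrix k l) (B : Matrix l r) Y i → ((A · B) ⊛ Y) i ≈ (A ⊛ B ⊛ Y) i
  ·-⊛ {k} {l} {r} A B Y i = begin
    sum (λ j → sum (λ x → A i x * B x j) * Y j)
      ≈⟨ sum-cong-≋ {r} (λ j → trans (*-distribʳ-sum (Y j) (λ x → A i x * B x j))
                                     (sum-cong-≋ {l} λ x → *-assoc _ _ _)) ⟩
    sum (λ j → sum (λ x → A i x * (B x j * Y j)))
      ≈⟨ ∑-comm {r} {l} (λ j x → A i x * (B x j * Y j)) ⟩
    sum (λ x → sum (λ j → A i x * (B x j * Y j)))
      ≈⟨ sum-cong-≋ {l} (λ x → *-distribˡ-sum (A i x) (λ j → B x j * Y j)) ⟨
    sum (λ x → A i x * (B ⊛ Y) x) ∎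

  ⊖-⊛ : ∀ {k l} (A B : Matrix k l) Y i → ((A ⊖ B) ⊛ Y) i ≈ (A ⊛ Y) i - (B ⊛ Y) i
  ⊖-⊛ {k} {l} A B Y i = begin
    sum (λ j → (A i j - B i j) * Y j)
      ≈⟨ sum-cong-≋ {l} (λ j → trans (distribʳ _ _ _) (+-congˡ (trans (*-congʳ (sym (-1*x≈-x _))) (*-assoc _ _ _)))) ⟩
    sum (λ j → A i j * Y j + - 1# * (B i j * Y j))
      ≈⟨ ∑-distrib-+ {l} (λ j → A i j * Y j) (λ j → - 1# * (B i j * Y j)) ⟩
    (A ⊛ Y) i + sum (λ j → - 1# * (B i j * Y j))
      ≈⟨ +-congˡ (trans (sym (*-distribˡ-sum (- 1#) (λ j → B i j * Y j))) (-1*x≈-x _)) ⟩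
    (A ⊛ Y) i - (B ⊛ Y) i ∎

  combination-identity : ∀ {k} α i → Dimension.combination R (coordinateSpace k) α (identity k) i ≈ α i
  combination-identity {k} α i = begin
    Dimension.combination R (coordinateSpace k) α (identity k) i
      ≡⟨ sum-coordinate (λ e j → α e * identity k e j) i ⟩
    sum (λ e → α e * identity k e i)
      ≈⟨ sum-cong-≋ {k} (λ e → *-comm (α e) _) ⟩
    sum (λ e → identity k e i * α e)
      ≈⟨ indicator-sum (Fin._≟ i) α i ≡.refl (λ _ eq → eq) ⟩
    α i ∎

  module _ {k l : ℕ} (A : Matrix k l) where
    open LeftModule (coordinateSpace l) using (_≈ᴹ_; _+ᴹ_; _*ₗ_; 0ᴹ; -ᴹ_)
    open LeftModule (coordinateSpace k) using ()
      renaming (_≈ᴹ_ to _≈ᴷ_; _+ᴹ_ to _+ᴷ_; _*ₗ_ to _*ᴷ_; 0ᴹ to 0ᴷ; -ᴹ_ to -ᴷ_)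

    ⊛-cong : ∀ {x y} → x ≈ᴹ y → (A ⊛ x) ≈ᴷ (A ⊛ y)
    ⊛-cong x≈y i = sum-cong-≋ {l} λ j → *-congˡ (x≈y j)

    ⊛-homo-+ : ∀ x y → (A ⊛ (x +ᴹ y)) ≈ᴷ (A ⊛ x) +ᴷ (A ⊛ y)
    ⊛-homo-+ x y i = trans (sum-cong-≋ {l} λ j → distribˡ _ _ _)
                           (∑-distrib-+ {l} (λ j → A i j * x j) (λ j → A i j * y j))

    ⊛-homo-* : ∀ a x → (A ⊛ (a *ₗ x)) ≈ᴷ a *ᴷ (A ⊛ x)
    ⊛-homo-* a x i = trans (sum-cong-≋ {l} λ j → x∙yz≈y∙xz (A i j) a (x j))
                           (sym (*-distribˡ-sum a (λ j → A i j * x j)))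

    ⊛-homo-0 : (A ⊛ 0ᴹ) ≈ᴷ 0ᴷ
    ⊛-homo-0 i = trans (sum-cong-≋ {l} λ j → zeroʳ (A i j)) (sum-replicate-zero l)

    ⊛-homo-- : ∀ x y → (A ⊛ (x +ᴹ -ᴹ y)) ≈ᴷ (A ⊛ x) +ᴷ -ᴷ (A ⊛ y)
    ⊛-homo-- x y i = begin
      (A ⊛ (x +ᴹ -ᴹ y)) i                 ≈⟨ ⊛-homo-+ x (-ᴹ y) i ⟩
      (A ⊛ x) i + (A ⊛ (-ᴹ y)) i          ≈⟨ +-congˡ (⊛-cong (λ j → sym (-1*x≈-x (y j))) i) ⟩
      (A ⊛ x) i + (A ⊛ (- 1# *ₗ y)) i     ≈⟨ +-congˡ (⊛-homo-* (- 1#) y i) ⟩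
      (A ⊛ x) i + - 1# * (A ⊛ y) i        ≈⟨ +-congˡ (-1*x≈-x _) ⟩
      (A ⊛ x) i - (A ⊛ y) i               ∎

    ⊛-combination : ∀ {d} (α : Vector Carrier d) (v : Vector (Vector Carrier l) d) →
                    (A ⊛ Dimension.combination R (coordinateSpace l) α v) ≈ᴷ
                    Dimension.combination R (coordinateSpace k) α (λ e → A ⊛ v e)
    ⊛-combination {zero}  α v = ⊛-homo-0
    ⊛-combination {suc d} α v i = trans (⊛-homo-+ (α zero *ₗ v zero) _ i)
      (+-cong (⊛-homo-* (α zero) (v zero) i) (⊛-combination (tail α) (tail v) i))

-- Rank and nullity

module RankNullity (𝔽 : HeytingField c ℓ₁ ℓ₂) {q : ℕ} (order : HasOrder (fieldRing 𝔽) q) where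
  private F = fieldRing 𝔽
  open CommutativeRing F hiding (zero)
  open Matrices F
  open MatrixAction F
  open FiniteField 𝔽 order using (_≈?_)
  open SetoidReasoning setoid

  module _ {k l : ℕ} (A : Matrix k l) where
    private
      module Dom where
        open LeftModule (coordinateSpace l) public
        open Combinations F (coordinateSpace l) public
        open Dimension F (coordinateSpace l) public
        open FiniteLinearAlgebra 𝔽 order (coordinateSpace l) public
      module Cod where
        open LeftModule (coordinateSpace k) public
        open Combinations F (coordinateSpace k) public
        open Dimension F (coordinateSpace k) public
        open FiniteLinearAlgebra 𝔽 order (coordinateSpace k) public

    -- A basis v of the null space and preimages w of a basis of the column space
    -- together form a basis of the domain.
    rank-nullity : ∀ {d r} → Dom.HasDimension (Null A) d → HasRank A r → d ℕ.+ r ≡ l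
    rank-nullity {d} {r} (v , Av≈0 , v-independent , Null⊆span) (y , y∈col , y-independent , col⊆span) =
      -- Both inequalities compare `v ++ w` with the standard basis, whose vectors are the rows of
      -- `identity l`.
      ℕ.≤-antisym
        (Dom.independent≤spanning independent λ i → (v ++ w) i , Dom.≈ᴹ-sym (combination-identity _))
        (Dom.independent≤spanning {v = identity l} {v ++ w}
          (λ α eq i → trans (sym (combination-identity α i)) (eq i)) λ i → spanning (identity l i))
      where
      w : Vector (Vector Carrier l) r
      w j = proj₁ (y∈col j)

      Aw≈y : ∀ (β : Vector Carrier r) i → (A ⊛ Dom.combination β w) i ≈ Cod.combination β y i
      Aw≈y β i = trans (⊛-combination A β w i)
        (Cod.combination-cong {r} {β} {β} (λ _ → refl) (λ j i → sym (proj₂ (y∈col j) i)) i)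

      A[γv]≈0 : ∀ (γ : Vector Carrier d) i → (A ⊛ Dom.combination γ v) i ≈ 0#
      A[γv]≈0 γ i = begin
        (A ⊛ Dom.combination γ v) i                     ≈⟨ ⊛-combination A γ v i ⟩
        Cod.combination γ (λ e → A ⊛ v e) i
          ≈⟨ Cod.combination-cong {d} {γ} {γ} {λ e → A ⊛ v e} {λ _ → Cod.0ᴹ} (λ _ → refl) Av≈0 i ⟩
        Cod.combination γ (λ _ → Cod.0ᴹ) i              ≈⟨ Cod.combination-of-0 γ i ⟩
        0#                                              ∎

      independent : Dom.LinearlyIndependent (v ++ w)
      independent α eq i = ≡.subst (λ i → α i ≈ 0#) (Fin.join-splitAt d r i) (both (splitAt d i))
        where
        αv = λ i → α (i ↑ˡ r)
        αw = λ j → α (d ↑ʳ j)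

        split≈0 : ∀ i → Dom.combination αv v i + Dom.combination αw w i ≈ 0#
        split≈0 i = trans (sym (Dom.combination-++ α v w i)) (eq i)

        -- Applying `A` kills the `v` part of the relation and leaves a relation among the `y j`.
        αw≈0 : ∀ j → αw j ≈ 0#
        αw≈0 = y-independent αw λ i → begin
          Cod.combination αw y i                ≈⟨ Aw≈y αw i ⟨
          (A ⊛ Dom.combination αw w) i          ≈⟨ +-identityˡ _ ⟨
          0# + (A ⊛ Dom.combination αw w) i     ≈⟨ +-congʳ (A[γv]≈0 αv i) ⟨
          (A ⊛ Dom.combination αv v) i + (A ⊛ Dom.combination αw w) i
            ≈⟨ ⊛-homo-+ A (Dom.combination αv v) (Dom.combination αw w) i ⟨
          (A ⊛ (Dom.combination αv v Dom.+ᴹ Dom.combination αw w)) i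
            ≈⟨ trans (⊛-cong A split≈0 i) (⊛-homo-0 A i) ⟩
          0#                                    ∎

        αv≈0 : ∀ i → αv i ≈ 0#
        αv≈0 = v-independent αv λ i → begin
          Dom.combination αv v i                              ≈⟨ +-identityʳ _ ⟨
          Dom.combination αv v i + 0#
            ≈⟨ +-congˡ (trans (Dom.combination-congʳ {α = αw} {λ _ → 0#} {w} αw≈0 i) (Dom.combination-0 w i)) ⟨
          Dom.combination αv v i + Dom.combination αw w i     ≈⟨ split≈0 i ⟩
          0#                                                  ∎

        both : ∀ s → α (Fin.join d r s) ≈ 0#
        both (inj₁ i) = αv≈0 i
        both (inj₂ j) = αw≈0 j

      spanning : ∀ x → Dom.Span (v ++ w) x
      spanning x = (γ ++ β) , λ i → begin
        x i                                                 ≈⟨ +-identityʳ (x i) ⟨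
        x i + 0#                                            ≈⟨ +-congˡ (-‿inverseˡ (z i)) ⟨
        x i + (- z i + z i)                                 ≈⟨ +-assoc (x i) _ _ ⟨
        (x i - z i) + z i                                   ≈⟨ +-congʳ (proj₂ x-z∈span i) ⟩
        Dom.combination γ v i + Dom.combination β w i       ≈⟨ Dom.combination-++-++ γ β v w i ⟨
        Dom.combination (γ ++ β) (v ++ w) i                 ∎
        where
        Ax∈span = col⊆span (A ⊛ x) (x , λ _ → refl)
        β = proj₁ Ax∈span
        z = Dom.combination β w

        null : Null A (λ j → x j - z j)
        null i = begin
          (A ⊛ (λ j → x j - z j)) i                          ≈⟨ ⊛-homo-- A x z i ⟩
          (A ⊛ x) i - (A ⊛ z) i                              ≈⟨ +-cong (proj₂ Ax∈span i) (-‿cong (Aw≈y β i)) ⟩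
          Cod.combination β y i - Cod.combination β y i      ≈⟨ -‿inverseʳ _ ⟩
          0#                                                 ∎

        x-z∈span = Null⊆span _ null
        γ = proj₁ x-z∈span

    rank-exists : ∃[ r ] HasRank A r
    rank-exists =
      let r , y , y∈col , independent , columns∈span = Cod.extract-basis (λ x y → Fin.all? λ i → x i ≈? y i)
            (ColumnSpace A) (λ j → A ⊛ identity l j) (λ j → identity l j , λ _ → refl)
      in r , y , y∈col , independent , λ x (z , x≈Az) → Cod.span-resp
           (λ i → trans (sym (⊛-combination A z (identity l) i))
                    (trans (⊛-cong A (combination-identity z) i) (sym (x≈Az i))))
           (Cod.span-combination z columns∈span)

-- Frobenius powers and semilinear maps

primePower⇒>1 : ∀ {q} → IsPrimePower q → 1 ℕ.< q
primePower⇒>1 (p , k , prime-p , 1≤k , ≡.refl) = ℕ.^-monoʳ-< p (ℕ.nonTrivial⇒n>1 p) 1≤k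
  where instance _ = prime⇒nonTrivial prime-p

-- `x ^ k - x` is monic of degree `k` only from `k = 2` on, hence the shape `2 + d`.
>1⇒2+ : ∀ {k} → 1 ℕ.< k → ∃[ d ] 2 ℕ.+ d ≡ k
>1⇒2+ (s≤s (s≤s {n = d} z≤n)) = d , ≡.refl

module Frobenius (𝕂 : HeytingField c ℓ₁ ℓ₂) {q m : ℕ} .{{_ : ℕ.NonZero m}} (q-primePower : IsPrimePower q)
                 (order : HasOrder (fieldRing 𝕂) (q ℕ.^ m)) where
  open FiniteField 𝕂 order
  private K = fieldRing 𝕂
  open CommutativeRing K hiding (zero)
  open Exp semiring
  open CommutativeExp commutativeSemiring using (^-distrib-*)
  open SemiringSum semiring
  open Polynomials K

  private
    1<q = primePower⇒>1 q-primePower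
    instance
      q≢0 : ℕ.NonZero q
      q≢0 = ℕ.>-nonZero (ℕ.<-trans (s≤s z≤n) 1<q)

  Fr : ℕ → Carrier → Carrier
  Fr e x = x ^ (q ℕ.^ e)

  Fr-cong : ∀ e → Congruent _≈_ _≈_ (Fr e)
  Fr-cong e = ^-congˡ (q ℕ.^ e)

  Fr-zero : ∀ x → Fr 0 x ≈ x
  Fr-zero = *-identityʳ

  Fr-+ : ∀ a b x → Fr (a ℕ.+ b) x ≈ Fr a (Fr b x)
  Fr-+ a b x = trans (^-congʳ x (≡.trans (ℕ.^-distribˡ-+-* q a b) (ℕ.*-comm (q ℕ.^ a) _)))
                     (sym (^-assocʳ x (q ℕ.^ b) (q ℕ.^ a)))

  Fr-homo-* : ∀ e x y → Fr e (x * y) ≈ Fr e x * Fr e y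
  Fr-homo-* e x y = ^-distrib-* x y (q ℕ.^ e)

  Fr-0# : ∀ e → Fr e 0# ≈ 0#
  Fr-0# e = 0^order (ℕ.m^n>0 q e)

  -- With `q` a power of the prime `r`, this is the prime case iterated; the order of the field
  -- forces `r ×′ 1# ≈ 0#`.
  Fr-homo-+ : ∀ e x y → Fr e (x + y) ≈ Fr e x + Fr e y
  Fr-homo-+ e x y = begin
    (x + y) ^ (q ℕ.^ e)                            ≈⟨ ^-congʳ (x + y) (q^≡r^ e) ⟩
    (x + y) ^ (r ℕ.^ (k ℕ.* e))                    ≈⟨ go (k ℕ.* e) x y ⟩
    x ^ (r ℕ.^ (k ℕ.* e)) + y ^ (r ℕ.^ (k ℕ.* e))  ≈⟨ +-cong (^-congʳ x (q^≡r^ e)) (^-congʳ y (q^≡r^ e)) ⟨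
    x ^ (q ℕ.^ e) + y ^ (q ℕ.^ e)                  ∎
    where
    open SetoidReasoning setoid
    r = proj₁ q-primePower
    k = proj₁ (proj₂ q-primePower)
    prime-r = proj₁ (proj₂ (proj₂ q-primePower))
    q≡r^k = proj₂ (proj₂ (proj₂ (proj₂ q-primePower)))

    q^≡r^ : ∀ e → q ℕ.^ e ≡ r ℕ.^ (k ℕ.* e)
    q^≡r^ e = ≡.trans (≡.cong (ℕ._^ e) q≡r^k) (ℕ.^-*-assoc r k e)

    r×1≈0 = characteristic (k ℕ.* m) (q^≡r^ m)

    go : ∀ j x y → (x + y) ^ (r ℕ.^ j) ≈ x ^ (r ℕ.^ j) + y ^ (r ℕ.^ j)
    go zero    x y = trans (*-identityʳ _) (sym (+-cong (*-identityʳ x) (*-identityʳ y)))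
    go (suc j) x y = begin
      (x + y) ^ (r ℕ.* r ℕ.^ j)                      ≈⟨ ^-assocʳ (x + y) r (r ℕ.^ j) ⟨
      ((x + y) ^ r) ^ (r ℕ.^ j)                      ≈⟨ ^-congˡ (r ℕ.^ j) (freshman prime-r commutativeSemiring r×1≈0 x y) ⟩
      (x ^ r + y ^ r) ^ (r ℕ.^ j)                    ≈⟨ go j (x ^ r) (y ^ r) ⟩
      (x ^ r) ^ (r ℕ.^ j) + (y ^ r) ^ (r ℕ.^ j)      ≈⟨ +-cong (^-assocʳ x r (r ℕ.^ j)) (^-assocʳ y r (r ℕ.^ j)) ⟩
      x ^ (r ℕ.* r ℕ.^ j) + y ^ (r ℕ.* r ℕ.^ j)      ∎

  Fr-sum : ∀ e {k} (g : Vector Carrier k) → Fr e (sum g) ≈ sum (Fr e ∘ g)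
  Fr-sum e {zero}  g = Fr-0# e
  Fr-sum e {suc k} g = trans (Fr-homo-+ e _ _) (+-congˡ (Fr-sum e (tail g)))

  Fr-period : ∀ a k x → Fr (a ℕ.+ m ℕ.* k) x ≈ Fr a x
  Fr-period a k x = trans (Fr-+ a _ x) (Fr-cong a (Fr-m* k))
    where
    Fr-m* : ∀ k → Fr (m ℕ.* k) x ≈ x
    Fr-m* zero    = trans (^-congʳ x (≡.cong (q ℕ.^_) (ℕ.*-zeroʳ m))) (Fr-zero x)
    Fr-m* (suc k) = trans (^-congʳ x (≡.cong (q ℕ.^_) (ℕ.*-suc m k)))
      (trans (Fr-+ m (m ℕ.* k) x) (trans (fermat _) (Fr-m* k)))

  Fr-comm : ∀ a b x → Fr a (Fr b x) ≈ Fr b (Fr a x)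
  Fr-comm a b x = trans (sym (Fr-+ a b x)) (trans (^-congʳ x (≡.cong (q ℕ.^_) (ℕ.+-comm a b))) (Fr-+ b a x))

  -- Another `m - 1` applications of `Fr e` give `Fr (m * e)`, the identity.
  Fr-injective : ∀ e → Injective _≈_ _≈_ (Fr e)
  Fr-injective e {x} {y} eq = trans (sym (undo x)) (trans (Fr-cong (ℕ.pred m ℕ.* e) eq) (undo y))
    where
    undo : ∀ z → Fr (ℕ.pred m ℕ.* e) (Fr e z) ≈ z
    undo z = trans (sym (Fr-+ (ℕ.pred m ℕ.* e) e z))
      (trans (^-congʳ z (≡.cong (q ℕ.^_) (≡.trans (ℕ.+-comm _ e) (≡.cong (ℕ._* e) (ℕ.suc-pred m)))))
        (trans (Fr-period 0 e z) (Fr-zero z)))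

  -- Otherwise every element would be a root of `x ^ (q ^ e) - x`. The first `q ^ e` listed elements
  -- would then exhaust the roots, giving an injection of `q ^ m` elements into `q ^ e`.
  Fr-nontrivial : ∀ e → 0 ℕ.< e → e ℕ.< m → ∃[ g ] ¬ Fr e g ≈ g
  Fr-nontrivial e 0<e e<m =
    let i , moved = Fin.¬∀⟶∃¬ _ _ (λ i → Fr e (element i) ≈? element i) not-all in element i , moved
    where
    q^e<q^m = ℕ.^-monoʳ-< q 1<q e<m
    2+d≡q^e = >1⇒2+ (ℕ.^-monoʳ-< q 1<q 0<e)

    not-all : ¬ (∀ i → Fr e (element i) ≈ element i)
    not-all fixed = ℕ.<⇒≱ q^e<q^m (Fin.injective⇒≤ {f = root} root-injective)
      where
      -- The degree is generalised to a variable so that it can be matched with `2 + d`, the shape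
      -- required by `monic-^-`.
      roots-of : ∀ k → ∃[ d ] 2 ℕ.+ d ≡ k → (k≤ : k ℕ.≤ q ℕ.^ m) → (∀ x → x ^ k ≈ x) →
                 ∀ x → ∃[ i ] x ≈ element (inject≤ {k} i k≤)
      roots-of _ (d , ≡.refl) k≤ all-fixed x = roots-exhaust integral 1≉0 (2 ℕ.+ d) (monic-^- d)
        (λ i → element (inject≤ i k≤)) (Fin.inject≤-injective k≤ k≤ _ _ ∘ element-injective)
        (λ i → is-root _) x (is-root x)
        where
        is-root : ∀ x → x ^ (2 ℕ.+ d) - x ≈ 0#
        is-root x = trans (+-congʳ (all-fixed x)) (-‿inverseʳ x)

      all-fixed : ∀ x → Fr e x ≈ x
      all-fixed x = trans (Fr-cong e (sym (element-index x))) (trans (fixed (index x)) (element-index x))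

      root-of : ∀ x → ∃[ i ] x ≈ element (inject≤ {q ℕ.^ e} i (ℕ.<⇒≤ q^e<q^m))
      root-of = roots-of (q ℕ.^ e) 2+d≡q^e (ℕ.<⇒≤ q^e<q^m) all-fixed

      root : Fin (q ℕ.^ m) → Fin (q ℕ.^ e)
      root i = proj₁ (root-of (element i))

      root-injective : Injective _≡_ _≡_ root
      root-injective {i} {j} eq = element-injective (trans (proj₂ (root-of (element i)))
        (trans (reflexive (≡.cong (λ k → element (inject≤ k (ℕ.<⇒≤ q^e<q^m))) eq))
               (sym (proj₂ (root-of (element j))))))

  -- The remainder of `e` modulo `m` induces the same map, and a nonzero remainder would move some
  -- element.
  Fr-trivial⇒∣ : ∀ e → (∀ x → Fr e x ≈ x) → m ∣ e
  Fr-trivial⇒∣ e trivial = ∣.m%n≡0⇒n∣m e m (decidable-stable (e % m ℕ.≟ 0) λ r≢0 →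
    let g , moved = Fr-nontrivial (e % m) (ℕ.n≢0⇒n>0 r≢0) (m%n<n e m)
    in moved (trans (sym (Fr-period (e % m) (e / m) g))
         (trans (^-congʳ g (≡.cong (q ℕ.^_) (≡.sym (≡.trans (m≡m%n+[m/n]*n e m)
           (≡.cong (e % m ℕ.+_) (ℕ.*-comm (e / m) m)))))) (trivial g))))

  -- The subfield of q elements

  module FixedField (𝔽 : HeytingField c′ ℓ₁′ ℓ₂′) (orderF : HasOrder (fieldRing 𝔽) q)
    {ι : CommutativeRing.Carrier (fieldRing 𝔽) → Carrier}
    (hom : IsRingHomomorphism (CommutativeRing.rawRing (fieldRing 𝔽)) (CommutativeRing.rawRing K) ι) where
    private
      module F = CommutativeRing (fieldRing 𝔽)
      module FF = FiniteField 𝔽 orderF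
      module ι = IsRingHomomorphism hom
    open RingProperties F.ring using (x∙y⁻¹≈ε⇒x≈y)
    open Exp F.semiring using () renaming (_^_ to _^ᶠ_)

    ι≈0 : ∀ {a} → ι a ≈ 0# → a F.≈ F.0#
    ι≈0 {a} ιa≈0 = decidable-stable (a FF.≈? F.0#) λ a≉0 →
      let a⁻¹ , inv = FF.inverse-of a≉0 in
      1≉0 (trans (sym (trans (ι.⟦⟧-cong inv) ι.1#-homo))
            (trans (ι.*-homo a a⁻¹) (trans (*-congʳ ιa≈0) (zeroˡ _))))

    ι-injective : Injective F._≈_ _≈_ ι
    ι-injective {a} {b} eq = x∙y⁻¹≈ε⇒x≈y a b (ι≈0 (trans (ι.+-homo a (F.- b))
      (trans (+-cong eq (ι.-‿homo b)) (-‿inverseʳ (ι b)))))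

    ι-^ : ∀ a k → ι (a ^ᶠ k) ≈ ι a ^ k
    ι-^ a zero    = ι.1#-homo
    ι-^ a (suc k) = trans (ι.*-homo a (a ^ᶠ k)) (*-congˡ (ι-^ a k))

    private
      ι-fixed₁ : ∀ a → ι a ^ q ≈ ι a
      ι-fixed₁ a = trans (sym (ι-^ a q)) (ι.⟦⟧-cong (FF.fermat a))

    Fr-ι : ∀ e a → Fr e (ι a) ≈ ι a
    Fr-ι zero    a = Fr-zero (ι a)
    Fr-ι (suc e) a = trans (sym (^-assocʳ (ι a) q (q ℕ.^ e))) (trans (Fr-cong e (ι-fixed₁ a)) (Fr-ι e a))

    -- The images under `ι` are already `q` distinct roots of `x ^ q - x`, so a further fixed
    -- element must be one of them.
    fixed⇒ι : ∀ x → Fr 1 x ≈ x → ∃[ a ] x ≈ ι a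
    fixed⇒ι x fixed =
      let i , x≈ = go q (>1⇒2+ 1<q) FF.element (FF.element-injective ∘ ι-injective)
                      (ι-fixed₁ ∘ FF.element) x^q≈x
      in FF.element i , x≈
      where
      x^q≈x : x ^ q ≈ x
      x^q≈x = trans (^-congʳ x (≡.sym (ℕ.*-identityʳ q))) fixed

      go : ∀ k → ∃[ d ] 2 ℕ.+ d ≡ k → (a : Vector F.Carrier k) → Injective _≡_ _≈_ (ι ∘ a) →
           (∀ i → ι (a i) ^ k ≈ ι (a i)) → x ^ k ≈ x → ∃[ i ] x ≈ ι (a i)
      go _ (d , ≡.refl) a injective fixed-a fixed-x =
        roots-exhaust integral 1≉0 (2 ℕ.+ d) (monic-^- d) (ι ∘ a) injective
          (λ i → trans (+-congʳ (fixed-a i)) (-‿inverseʳ _)) x (trans (+-congʳ fixed-x) (-‿inverseʳ x))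

  -- Semilinear maps and their traces

  module Semilinearity (V : LeftModule ring p ℓm) where
    open LeftModule V
    open Combinations K V
    open Dimension K V using (combination)
    private module ∑ = Sum +ᴹ-commutativeMonoid
    open SetoidReasoning ≈ᴹ-setoid
    open AbelianGroupProperties +ᴹ-abelianGroup using (inverseʳ-unique)

    record Semilinear (e : ℕ) (H : Carrierᴹ → Carrierᴹ) : Set (c ⊔ p ⊔ ℓm) where
      field
        cong : Congruent _≈ᴹ_ _≈ᴹ_ H
        homo-+ : ∀ x y → H (x +ᴹ y) ≈ᴹ H x +ᴹ H y
        homo-* : ∀ a x → H (a *ₗ x) ≈ᴹ Fr e a *ₗ H x

      homo-0 : H 0ᴹ ≈ᴹ 0ᴹ
      homo-0 = begin
        H 0ᴹ               ≈⟨ cong (*ₗ-zeroˡ 0ᴹ) ⟨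
        H (0# *ₗ 0ᴹ)       ≈⟨ homo-* 0# 0ᴹ ⟩
        Fr e 0# *ₗ H 0ᴹ    ≈⟨ *ₗ-congʳ (Fr-0# e) ⟩
        0# *ₗ H 0ᴹ         ≈⟨ *ₗ-zeroˡ _ ⟩
        0ᴹ                 ∎

      homo-sum : ∀ {k} (x : Vector Carrierᴹ k) → H (∑.sum x) ≈ᴹ ∑.sum (H ∘ x)
      homo-sum {zero}  x = homo-0
      homo-sum {suc k} x = ≈ᴹ-trans (homo-+ _ _) (+ᴹ-congˡ (homo-sum (tail x)))

      homo-combination : ∀ {k} (α : Vector Carrier k) x →
                         H (combination α x) ≈ᴹ combination (Fr e ∘ α) (H ∘ x)
      homo-combination {k} α x = ≈ᴹ-trans (homo-sum (λ i → α i *ₗ x i)) (∑.sum-cong-≋ {k} λ i → homo-* (α i) (x i))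

    open Semilinear

    id-semilinear : Semilinear 0 id
    id-semilinear = record
      { cong = id
      ; homo-+ = λ _ _ → ≈ᴹ-refl
      ; homo-* = λ a x → *ₗ-congʳ (sym (Fr-zero a))
      }

    ∘-semilinear : ∀ {d e G H} → Semilinear d G → Semilinear e H → Semilinear (d ℕ.+ e) (G ∘ H)
    ∘-semilinear {d} {e} G H = record
      { cong = cong G ∘ cong H
      ; homo-+ = λ x y → ≈ᴹ-trans (cong G (homo-+ H x y)) (homo-+ G _ _)
      ; homo-* = λ a x → ≈ᴹ-trans (cong G (homo-* H a x)) (≈ᴹ-trans (homo-* G _ _) (*ₗ-congʳ (sym (Fr-+ d e a))))
      }

    fold-semilinear : ∀ {e H} → Semilinear e H → ∀ i → Semilinear (i ℕ.* e) (λ x → fold x H i)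
    fold-semilinear H zero    = id-semilinear
    fold-semilinear H (suc i) = ∘-semilinear H (fold-semilinear H i)

    -- Only the automorphism matters, so the degree of a semilinear map may be reduced modulo `m`.
    degree-cong : ∀ {d e H} → (∀ a → Fr d a ≈ Fr e a) → Semilinear d H → Semilinear e H
    degree-cong d≈e H = record
      { cong = cong H ; homo-+ = homo-+ H ; homo-* = λ a x → ≈ᴹ-trans (homo-* H a x) (*ₗ-congʳ (d≈e a)) }

    trace : (Carrierᴹ → Carrierᴹ) → Carrierᴹ → Carrierᴹ
    trace H x = ∑.sum {m} (λ i → fold x H (toℕ i))

    trace-cong : ∀ {e H} → Semilinear e H → Congruent _≈ᴹ_ _≈ᴹ_ (trace H)
    trace-cong H x≈y = ∑.sum-cong-≋ {m} λ i → cong (fold-semilinear H (toℕ i)) x≈y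

    -- `H` permutes the terms of the trace cyclically. Periodicity is asked of the single vector
    -- `x`, since in the application `H` need not be periodic on the whole space.
    trace-fixed : ∀ {e H x} → Semilinear e H → fold x H m ≈ᴹ x → H (trace H x) ≈ᴹ trace H x
    trace-fixed {e} {H} {x} H-semilinear = go m
      where
      go : ∀ k → fold x H k ≈ᴹ x →
           H (∑.sum {k} (λ i → fold x H (toℕ i))) ≈ᴹ ∑.sum {k} (λ i → fold x H (toℕ i))
      go zero    _        = homo-0 H-semilinear
      go (suc k) periodic = begin
        H (∑.sum {suc k} (λ i → fold x H (toℕ i)))
          ≈⟨ homo-sum H-semilinear {suc k} (λ i → fold x H (toℕ i)) ⟩
        ∑.sum {suc k} (λ i → H (fold x H (toℕ i)))
          ≈⟨ ∑.sum-init-last {k} (λ i → H (fold x H (toℕ i))) ⟩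
        ∑.sum {k} (λ i → H (fold x H (toℕ (inject₁ i)))) +ᴹ H (fold x H (toℕ (fromℕ k)))
          ≈⟨ +ᴹ-cong (∑.sum-cong-≋ {k} λ i → ≈ᴹ-reflexive (≡.cong (λ j → H (fold x H j)) (Fin.toℕ-inject₁ i)))
                     (≈ᴹ-trans (≈ᴹ-reflexive (≡.cong (λ j → H (fold x H j)) (Fin.toℕ-fromℕ k))) periodic) ⟩
        ∑.sum {k} (λ i → H (fold x H (toℕ i))) +ᴹ x
          ≈⟨ +ᴹ-comm _ _ ⟩
        x +ᴹ ∑.sum {k} (λ i → H (fold x H (toℕ i))) ∎

    private
      1<q^m : 1 ℕ.< q ℕ.^ m
      1<q^m = ℕ.^-monoʳ-< q 1<q (ℕ.>-nonZero⁻¹ m)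

    M = proj₁ (>1⇒2+ 1<q^m)
    open PowerSums M (proj₂ (>1⇒2+ 1<q^m))

    -- Interchanging the two sums makes the coefficient of H^i x equal to `powerSum (q ^ i)`, and
    -- only `i = 0` survives.
    reconstruction : ∀ {H} → Semilinear 1 H → ∀ x →
      ∑.sum (λ k → element k ^ M *ₗ trace H (element k *ₗ x)) +ᴹ x ≈ᴹ 0ᴹ
    reconstruction {H} H-semilinear x = begin
      ∑.sum (λ k → element k ^ M *ₗ trace H (element k *ₗ x)) +ᴹ x
        ≈⟨ +ᴹ-congʳ (∑.sum-cong-≋ {q ℕ.^ m} λ k → ≈ᴹ-trans
             (*ₗ-distribˡ-sum {m} (element k ^ M) (λ i → fold (element k *ₗ x) H (toℕ i)))
             (∑.sum-cong-≋ {m} λ i → summand k (toℕ i))) ⟩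
      ∑.sum (λ k → ∑.sum {m} (λ i → (element k ^ M * Fr (toℕ i) (element k)) *ₗ fold x H (toℕ i))) +ᴹ x
        ≈⟨ +ᴹ-congʳ (∑.∑-comm {q ℕ.^ m} {m} (λ k i → (element k ^ M * Fr (toℕ i) (element k)) *ₗ fold x H (toℕ i))) ⟩
      ∑.sum {m} (λ i → ∑.sum (λ k → (element k ^ M * Fr (toℕ i) (element k)) *ₗ fold x H (toℕ i))) +ᴹ x
        ≈⟨ +ᴹ-congʳ (∑.sum-cong-≋ {m} λ i →
             *ₗ-distribʳ-sum (λ k → element k ^ M * Fr (toℕ i) (element k)) (fold x H (toℕ i))) ⟨
      ∑.sum {m} (λ i → powerSum (q ℕ.^ toℕ i) *ₗ fold x H (toℕ i)) +ᴹ x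
        ≈⟨ +ᴹ-congʳ (≈ᴹ-trans (sum-single +ᴹ-commutativeMonoid _ 0F others)
             (≈ᴹ-reflexive (≡.cong (λ i → powerSum (q ℕ.^ i) *ₗ fold x H i) toℕ-0F))) ⟩
      powerSum 1 *ₗ x +ᴹ x
        ≈⟨ +ᴹ-congˡ (*ₗ-identityˡ x) ⟨
      powerSum 1 *ₗ x +ᴹ 1# *ₗ x
        ≈⟨ *ₗ-distribʳ x _ _ ⟨
      (powerSum 1 + 1#) *ₗ x
        ≈⟨ *ₗ-congʳ powerSum-1 ⟩
      0# *ₗ x
        ≈⟨ *ₗ-zeroˡ x ⟩
      0ᴹ ∎
      where
      0<m = ℕ.>-nonZero⁻¹ m
      0F = fromℕ< 0<m

      toℕ-0F : toℕ 0F ≡ 0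
      toℕ-0F = Fin.toℕ-fromℕ< 0<m

      positive : ∀ {i} → i ≢ 0F → 0 ℕ.< toℕ i
      positive i≢0 = ℕ.n≢0⇒n>0 λ i≡0 → i≢0 (Fin.toℕ-injective (≡.trans i≡0 (≡.sym toℕ-0F)))

      summand : ∀ k i → element k ^ M *ₗ fold (element k *ₗ x) H i ≈ᴹ
                        (element k ^ M * Fr i (element k)) *ₗ fold x H i
      summand k i = ≈ᴹ-trans (*ₗ-congˡ (≈ᴹ-trans (homo-* (fold-semilinear H-semilinear i) (element k) x)
          (*ₗ-congʳ (reflexive (≡.cong (λ j → Fr j (element k)) (ℕ.*-identityʳ i))))))
        (≈ᴹ-sym (*ₗ-assoc _ _ _))

      -- An element `g` moved by `Fr i` is what the vanishing of the power sum requires; it is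
      -- nonzero because `Fr i` fixes zero.
      others : ∀ i → i ≢ 0F → powerSum (q ℕ.^ toℕ i) *ₗ fold x H (toℕ i) ≈ᴹ 0ᴹ
      others i i≢0 =
        let g , moved = Fr-nontrivial (toℕ i) (positive i≢0) (Fin.toℕ<n i)
        in ≈ᴹ-trans (*ₗ-congʳ (powerSum-≈0 (q ℕ.^ toℕ i) g moved λ g≈0 →
             moved (trans (Fr-cong (toℕ i) g≈0) (trans (Fr-0# (toℕ i)) (sym g≈0))))) (*ₗ-zeroˡ _)

    -- On `K` itself with `H = Fr 1` this is the nondegeneracy of the trace form.
    traces≈0⇒≈0 : ∀ {H} → Semilinear 1 H → ∀ x → (∀ a → trace H (a *ₗ x) ≈ᴹ 0ᴹ) → x ≈ᴹ 0ᴹ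
    traces≈0⇒≈0 H x traces≈0 = ≈ᴹ-trans (≈ᴹ-sym (+ᴹ-identityˡ x)) (≈ᴹ-trans
      (+ᴹ-congʳ (≈ᴹ-sym (≈ᴹ-trans
        (∑.sum-cong-≋ {q ℕ.^ m} λ k → ≈ᴹ-trans (*ₗ-congˡ (traces≈0 (element k))) (*ₗ-zeroʳ _))
        (∑.sum-replicate-zero (q ℕ.^ m)))))
      (reconstruction H x))

    -- `reconstruction` writes `x` as minus a combination of such traces; this is the spanning half
    -- of descent.
    traces∈span⇒∈span : ∀ {H} → Semilinear 1 H → ∀ {k} {v : Vector Carrierᴹ k} x →
                        (∀ a → Span v (trace H (a *ₗ x))) → Span v x
    traces∈span⇒∈span H {v = v} x traces∈span = span-resp
      (≈ᴹ-trans (≈ᴹ-sym (-ᴹ≈-1*ₗ _)) (≈ᴹ-sym (inverseʳ-unique _ x (reconstruction H x))))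
      (span-* {v = v} (- 1#) (span-combination _ λ k → traces∈span (element k)))

  Fr-semilinear : Semilinearity.Semilinear (TensorUnit.leftModule {R = ring}) 1 (Fr 1)
  Fr-semilinear = record { cong = Fr-cong 1 ; homo-+ = Fr-homo-+ 1 ; homo-* = Fr-homo-* 1 }

  fold-Fr : ∀ e x i → fold x (Fr e) i ≈ Fr (i ℕ.* e) x
  fold-Fr e x zero    = sym (Fr-zero x)
  fold-Fr e x (suc i) = trans (Fr-cong e (fold-Fr e x i)) (sym (Fr-+ e (i ℕ.* e) x))

-- Galois descent

-- Bézout's identity modulo n t, where it holds with nonnegative coefficients.
bézout-mod : ∀ u n t .{{_ : ℕ.NonZero n}} .{{_ : ℕ.NonZero t}} → gcd u n ≡ 1 →
             ∃[ α ] ∃[ β ] ∃[ k ] α ℕ.* u ℕ.+ β ℕ.* n ≡ 1 ℕ.+ n ℕ.* t ℕ.* k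
bézout-mod u n t coprime with Bézout.identity (≡.subst (GCD u n) coprime (gcd-GCD u n))
-- The negative Bézout coefficient is made positive by adding a multiple of `n * t`: here `- y * n`
-- becomes `y * (t - 1) * n`, and in the other case `- x * u` becomes `x * (n * t - 1) * u`.
... | Bézout.Identity.+- x y eq = x , y ℕ.* ℕ.pred t , y , (begin
    x ℕ.* u ℕ.+ y ℕ.* ℕ.pred t ℕ.* n          ≡⟨ ≡.cong (ℕ._+ y ℕ.* ℕ.pred t ℕ.* n) (≡.sym eq) ⟩
    1 ℕ.+ y ℕ.* n ℕ.+ y ℕ.* ℕ.pred t ℕ.* n    ≡⟨ regroup n (ℕ.pred t) y ⟩
    1 ℕ.+ n ℕ.* suc (ℕ.pred t) ℕ.* y          ≡⟨ ≡.cong (λ t → 1 ℕ.+ n ℕ.* t ℕ.* y) (ℕ.suc-pred t) ⟩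
    1 ℕ.+ n ℕ.* t ℕ.* y                       ∎)
  where
  open ≡.≡-Reasoning
  regroup : ∀ n t′ y → 1 ℕ.+ y ℕ.* n ℕ.+ y ℕ.* t′ ℕ.* n ≡ 1 ℕ.+ n ℕ.* suc t′ ℕ.* y
  regroup = solve-∀
... | Bézout.Identity.-+ x y eq = x ℕ.* ℕ.pred (n ℕ.* t) , y , x ℕ.* u , (begin
    x ℕ.* ℕ.pred (n ℕ.* t) ℕ.* u ℕ.+ y ℕ.* n              ≡⟨ ≡.cong (x ℕ.* ℕ.pred (n ℕ.* t) ℕ.* u ℕ.+_) (≡.sym eq) ⟩
    x ℕ.* ℕ.pred (n ℕ.* t) ℕ.* u ℕ.+ (1 ℕ.+ x ℕ.* u)      ≡⟨ regroup (ℕ.pred (n ℕ.* t)) x u ⟩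
    1 ℕ.+ suc (ℕ.pred (n ℕ.* t)) ℕ.* (x ℕ.* u)            ≡⟨ ≡.cong (λ m → 1 ℕ.+ m ℕ.* (x ℕ.* u)) (ℕ.suc-pred (n ℕ.* t)) ⟩
    1 ℕ.+ n ℕ.* t ℕ.* (x ℕ.* u)                     ∎)
  where
  open ≡.≡-Reasoning
  instance _ = ℕ.m*n≢0 n t
  regroup : ∀ m′ x u → x ℕ.* m′ ℕ.* u ℕ.+ (1 ℕ.+ x ℕ.* u) ≡ 1 ℕ.+ suc m′ ℕ.* (x ℕ.* u)
  regroup = solve-∀

-- Iterates of two commuting maps

module CommutingIterates (S : Setoid c ℓ) (Ψ G : Setoid.Carrier S → Setoid.Carrier S)
  (Ψ-cong : Congruent (Setoid._≈_ S) (Setoid._≈_ S) Ψ)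
  (G-cong : Congruent (Setoid._≈_ S) (Setoid._≈_ S) G)
  (ΨG≈GΨ : ∀ x → Setoid._≈_ S (Ψ (G x)) (G (Ψ x))) where
  open Setoid S
  open SetoidReasoning S

  fold-cong : ∀ {H} → Congruent _≈_ _≈_ H → ∀ k {x y} → x ≈ y → fold x H k ≈ fold y H k
  fold-cong H-cong zero    x≈y = x≈y
  fold-cong H-cong (suc k) x≈y = H-cong (fold-cong H-cong k x≈y)

  fold-+′ : ∀ {H} a b x → fold x H (a ℕ.+ b) ≈ fold (fold x H b) H a
  fold-+′ {H} a b x = reflexive (fold-+ x H a)

  fold-fixed : ∀ {H x} → Congruent _≈_ _≈_ H → H x ≈ x → ∀ k → fold x H k ≈ x
  fold-fixed H-cong fixed zero    = refl
  fold-fixed H-cong fixed (suc k) = trans (H-cong (fold-fixed H-cong fixed k)) fixed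

  fold-commutes : ∀ {H} → Congruent _≈_ _≈_ H → (∀ x → G (H x) ≈ H (G x)) →
                  ∀ a x → G (fold x H a) ≈ fold (G x) H a
  fold-commutes H-cong comm zero    x = refl
  fold-commutes H-cong comm (suc a) x = trans (comm _) (H-cong (fold-commutes H-cong comm a x))

  GΨ^≈Ψ^G : ∀ a x → G (fold x Ψ a) ≈ fold (G x) Ψ a
  GΨ^≈Ψ^G = fold-commutes Ψ-cong (λ x → sym (ΨG≈GΨ x))

  G^Ψ^≈Ψ^G^ : ∀ b a x → fold (fold x Ψ a) G b ≈ fold (fold x G b) Ψ a
  G^Ψ^≈Ψ^G^ zero    a x = refl
  G^Ψ^≈Ψ^G^ (suc b) a x = trans (G-cong (G^Ψ^≈Ψ^G^ b a x)) (GΨ^≈Ψ^G a _)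

  -- A normal form for words in the two maps: composition and iteration become arithmetic of
  -- exponents.
  Ψ^_G^_ : ℕ → ℕ → Carrier → Carrier
  (Ψ^ a G^ b) x = fold (fold x G b) Ψ a

  Ψ^G^-cong : ∀ a b → Congruent _≈_ _≈_ (Ψ^ a G^ b)
  Ψ^G^-cong a b = fold-cong Ψ-cong a ∘ fold-cong G-cong b

  Ψ^G^-∘ : ∀ a b a′ b′ x → (Ψ^ a G^ b) ((Ψ^ a′ G^ b′) x) ≈ (Ψ^ (a ℕ.+ a′) G^ (b ℕ.+ b′)) x
  Ψ^G^-∘ a b a′ b′ x = begin
    fold (fold (fold (fold x G b′) Ψ a′) G b) Ψ a  ≈⟨ fold-cong Ψ-cong a (G^Ψ^≈Ψ^G^ b a′ _) ⟩
    fold (fold (fold (fold x G b′) G b) Ψ a′) Ψ a  ≈⟨ fold-+′ a a′ _ ⟨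
    fold (fold (fold x G b′) G b) Ψ (a ℕ.+ a′)     ≈⟨ fold-cong Ψ-cong (a ℕ.+ a′) (fold-+′ b b′ x) ⟨
    fold (fold x G (b ℕ.+ b′)) Ψ (a ℕ.+ a′)        ∎

  fold-Ψ^G^ : ∀ a b j x → fold x (Ψ^ a G^ b) j ≈ (Ψ^ (j ℕ.* a) G^ (j ℕ.* b)) x
  fold-Ψ^G^ a b zero    x = refl
  fold-Ψ^G^ a b (suc j) x = trans (Ψ^G^-cong a b (fold-Ψ^G^ a b j x)) (Ψ^G^-∘ a b (j ℕ.* a) (j ℕ.* b) x)

  Ψ^G^-index : ∀ {a b a′ b′} x → a ≡ a′ → b ≡ b′ → (Ψ^ a G^ b) x ≈ (Ψ^ a′ G^ b′) x
  Ψ^G^-index x ≡.refl ≡.refl = refl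

  module _ {n t u : ℕ} (G^t≈id : ∀ x → fold x G t ≈ x) where

    G-period : ∀ a b j x → (Ψ^ a G^ (b ℕ.+ j ℕ.* t)) x ≈ (Ψ^ a G^ b) x
    G-period a b zero    x = Ψ^G^-index {a} {b ℕ.+ 0} {a} {b} x ≡.refl (ℕ.+-identityʳ b)
    G-period a b (suc j) x = begin
      (Ψ^ a G^ (b ℕ.+ (t ℕ.+ j ℕ.* t))) x
        ≈⟨ Ψ^G^-index {a} {_} {a} x ≡.refl (≡.trans (≡.cong (b ℕ.+_) (ℕ.+-comm t _)) (≡.sym (ℕ.+-assoc b _ t))) ⟩
      (Ψ^ a G^ ((b ℕ.+ j ℕ.* t) ℕ.+ t)) x
        ≈⟨ fold-cong Ψ-cong a (trans (fold-+′ (b ℕ.+ j ℕ.* t) t x) (fold-cong G-cong (b ℕ.+ j ℕ.* t) (G^t≈id x))) ⟩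
      (Ψ^ a G^ (b ℕ.+ j ℕ.* t)) x
        ≈⟨ G-period a b j x ⟩
      (Ψ^ a G^ b) x ∎

    module _ {x : Carrier} (Ψ^n≈G^u : fold x Ψ n ≈ fold x G u) where

      -- The relation Ψ^n = G^u is known at `x` alone, so each block of `n` copies of `Ψ` is first
      -- moved next to `x` and only then traded for `u` copies of `G`.
      exchange : ∀ a b j → (Ψ^ (a ℕ.+ j ℕ.* n) G^ b) x ≈ (Ψ^ a G^ (b ℕ.+ j ℕ.* u)) x
      exchange a b zero    = Ψ^G^-index {a ℕ.+ 0} {b} x (ℕ.+-identityʳ a) (≡.sym (ℕ.+-identityʳ b))
      exchange a b (suc j) = begin
        (Ψ^ (a ℕ.+ (n ℕ.+ j ℕ.* n)) G^ b) x
          ≈⟨ Ψ^G^-index {b = b} x (≡.trans (≡.cong (a ℕ.+_) (ℕ.+-comm n _)) (≡.sym (ℕ.+-assoc a _ n)))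
                                  (≡.sym (ℕ.+-identityʳ b)) ⟩
        (Ψ^ ((a ℕ.+ j ℕ.* n) ℕ.+ n) G^ (b ℕ.+ 0)) x
          ≈⟨ Ψ^G^-∘ (a ℕ.+ j ℕ.* n) b n 0 x ⟨
        (Ψ^ (a ℕ.+ j ℕ.* n) G^ b) (fold x Ψ n)
          ≈⟨ Ψ^G^-cong (a ℕ.+ j ℕ.* n) b Ψ^n≈G^u ⟩
        (Ψ^ (a ℕ.+ j ℕ.* n) G^ b) ((Ψ^ 0 G^ u) x)
          ≈⟨ Ψ^G^-∘ (a ℕ.+ j ℕ.* n) b 0 u x ⟩
        (Ψ^ (a ℕ.+ j ℕ.* n ℕ.+ 0) G^ (b ℕ.+ u)) x
          ≈⟨ Ψ^G^-index {b = b ℕ.+ u} x (ℕ.+-identityʳ (a ℕ.+ j ℕ.* n)) ≡.refl ⟩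
        (Ψ^ (a ℕ.+ j ℕ.* n) G^ (b ℕ.+ u)) x
          ≈⟨ exchange a (b ℕ.+ u) j ⟩
        (Ψ^ a G^ (b ℕ.+ u ℕ.+ j ℕ.* u)) x
          ≈⟨ Ψ^G^-index {a} x ≡.refl (ℕ.+-assoc b u _) ⟩
        (Ψ^ a G^ (b ℕ.+ (u ℕ.+ j ℕ.* u))) x ∎

      module _ {α β k : ℕ} (bézout : α ℕ.* u ℕ.+ β ℕ.* n ≡ 1 ℕ.+ n ℕ.* t ℕ.* k) where
        private H = Ψ^ α G^ β

        -- Trading all `n * α` copies of `Ψ` leaves `α * u + β * n` copies of `G`, a number
        -- congruent to 1 modulo `t`.
        H^n≈G : fold x H n ≈ G x
        H^n≈G = begin
          fold x H n                              ≈⟨ fold-Ψ^G^ α β n x ⟩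
          (Ψ^ (n ℕ.* α) G^ (n ℕ.* β)) x           ≈⟨ Ψ^G^-index {b = n ℕ.* β} x (ℕ.*-comm n α) ≡.refl ⟩
          (Ψ^ (0 ℕ.+ α ℕ.* n) G^ (n ℕ.* β)) x     ≈⟨ exchange 0 (n ℕ.* β) α ⟩
          (Ψ^ 0 G^ (n ℕ.* β ℕ.+ α ℕ.* u)) x       ≈⟨ Ψ^G^-index {0} x ≡.refl index ⟩
          (Ψ^ 0 G^ (1 ℕ.+ (k ℕ.* n) ℕ.* t)) x     ≈⟨ G-period 0 1 (k ℕ.* n) x ⟩
          G x                                     ∎
          where
          regroup : ∀ k n t → 1 ℕ.+ n ℕ.* t ℕ.* k ≡ 1 ℕ.+ (k ℕ.* n) ℕ.* t
          regroup = solve-∀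
          index : n ℕ.* β ℕ.+ α ℕ.* u ≡ 1 ℕ.+ (k ℕ.* n) ℕ.* t
          index = ≡.trans (≡.trans (≡.cong (ℕ._+ α ℕ.* u) (ℕ.*-comm n β)) (ℕ.+-comm _ (α ℕ.* u)))
                          (≡.trans bézout (regroup k n t))

        -- The trade goes the other way: `β * u` copies of `G` become `β * n` copies of `Ψ`, for a
        -- total of `1 + n * t * k`. The surplus returns to `G` as a multiple of `t` and disappears.
        H^u≈Ψ : fold x H u ≈ Ψ x
        H^u≈Ψ = begin
          fold x H u                                       ≈⟨ fold-Ψ^G^ α β u x ⟩
          (Ψ^ (u ℕ.* α) G^ (u ℕ.* β)) x                    ≈⟨ Ψ^G^-index {u ℕ.* α} x ≡.refl (ℕ.*-comm u β) ⟩
          (Ψ^ (u ℕ.* α) G^ (0 ℕ.+ β ℕ.* u)) x              ≈⟨ exchange (u ℕ.* α) 0 β ⟨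
          (Ψ^ (u ℕ.* α ℕ.+ β ℕ.* n) G^ 0) x                ≈⟨ Ψ^G^-index {b = 0} x index ≡.refl ⟩
          (Ψ^ (1 ℕ.+ (k ℕ.* t) ℕ.* n) G^ 0) x              ≈⟨ exchange 1 0 (k ℕ.* t) ⟩
          (Ψ^ 1 G^ (0 ℕ.+ (k ℕ.* t) ℕ.* u)) x              ≈⟨ Ψ^G^-index {1} x ≡.refl (regroup′ k t u) ⟩
          (Ψ^ 1 G^ (0 ℕ.+ (k ℕ.* u) ℕ.* t)) x              ≈⟨ G-period 1 0 (k ℕ.* u) x ⟩
          Ψ x                                              ∎
          where
          regroup : ∀ k n t → 1 ℕ.+ n ℕ.* t ℕ.* k ≡ 1 ℕ.+ (k ℕ.* t) ℕ.* n
          regroup = solve-∀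
          regroup′ : ∀ k t u → (k ℕ.* t) ℕ.* u ≡ (k ℕ.* u) ℕ.* t
          regroup′ = solve-∀
          index : u ℕ.* α ℕ.+ β ℕ.* n ≡ 1 ℕ.+ (k ℕ.* t) ℕ.* n
          index = ≡.trans (≡.cong (ℕ._+ β ℕ.* n) (ℕ.*-comm u α)) (≡.trans bézout (regroup k n t))

        -- Both exponents are multiples of `n * t`, so trading every `Ψ` leaves a power of `G` whose
        -- exponent is a multiple of `t`.
        H^nt≈id : fold x H (n ℕ.* t) ≈ x
        H^nt≈id = begin
          fold x H (n ℕ.* t)                                    ≈⟨ fold-Ψ^G^ α β (n ℕ.* t) x ⟩
          (Ψ^ (n ℕ.* t ℕ.* α) G^ (n ℕ.* t ℕ.* β)) x             ≈⟨ Ψ^G^-index {b = n ℕ.* t ℕ.* β} x (regroup n t α) ≡.refl ⟩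
          (Ψ^ (0 ℕ.+ (t ℕ.* α) ℕ.* n) G^ (n ℕ.* t ℕ.* β)) x     ≈⟨ exchange 0 (n ℕ.* t ℕ.* β) (t ℕ.* α) ⟩
          (Ψ^ 0 G^ (n ℕ.* t ℕ.* β ℕ.+ (t ℕ.* α) ℕ.* u)) x       ≈⟨ Ψ^G^-index {0} x ≡.refl (regroup′ n t α β u) ⟩
          (Ψ^ 0 G^ (0 ℕ.+ (n ℕ.* β ℕ.+ α ℕ.* u) ℕ.* t)) x       ≈⟨ G-period 0 0 (n ℕ.* β ℕ.+ α ℕ.* u) x ⟩
          x                                                     ∎
          where
          regroup : ∀ n t α → n ℕ.* t ℕ.* α ≡ (t ℕ.* α) ℕ.* n
          regroup = solve-∀
          regroup′ : ∀ n t α β u → n ℕ.* t ℕ.* β ℕ.+ (t ℕ.* α) ℕ.* u ≡ (n ℕ.* β ℕ.+ α ℕ.* u) ℕ.* t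
          regroup′ = solve-∀

-- Bases of the fixed vectors and of W

module Descent
  (𝔽 : HeytingField c ℓ₁ ℓ₂) (𝕂 : HeytingField c′ ℓ₁′ ℓ₂′) {q n t u : ℕ} .{{_ : ℕ.NonZero n}} .{{_ : ℕ.NonZero t}}
  (q-primePower : IsPrimePower q) (coprime : gcd u n ≡ 1)
  (orderF : HasOrder (fieldRing 𝔽) q) (orderK : HasOrder (fieldRing 𝕂) (q ℕ.^ (n ℕ.* t)))
  {ι : CommutativeRing.Carrier (fieldRing 𝔽) → CommutativeRing.Carrier (fieldRing 𝕂)}
  (hom : IsRingHomomorphism (CommutativeRing.rawRing (fieldRing 𝔽)) (CommutativeRing.rawRing (fieldRing 𝕂)) ι)
  (V : LeftModule (CommutativeRing.ring (fieldRing 𝕂)) m ℓm)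
  where
  open LeftModule V
  private instance
    nt≢0 : ℕ.NonZero (n ℕ.* t)
    nt≢0 = ℕ.m*n≢0 n t
  private
    module F = CommutativeRing (fieldRing 𝔽)
  open Frobenius 𝕂 {q} {n ℕ.* t} q-primePower orderK
  open FixedField 𝔽 orderF hom
  open Semilinearity V
  open CommutativeRing (fieldRing 𝕂) hiding (zero)
  open Dimension (fieldRing 𝕂) V
  open Combinations (fieldRing 𝕂) V
  private
    module ∑ = Sum +ᴹ-commutativeMonoid
    module Unit = Semilinearity (TensorUnit.leftModule {R = ring})
  open Semilinear

  module _ {Ψ G : Carrierᴹ → Carrierᴹ} (Ψ-semilinear : Semilinear u Ψ) (G-semilinear : Semilinear n G)
    (ΨG≈GΨ : ∀ x → Ψ (G x) ≈ᴹ G (Ψ x)) (G^t≈id : ∀ x → fold x G t ≈ᴹ x) where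
    open CommutingIterates ≈ᴹ-setoid Ψ G (cong Ψ-semilinear) (cong G-semilinear) ΨG≈GΨ
    open SetoidReasoning ≈ᴹ-setoid

    W : Pred Carrierᴹ ℓm
    W x = fold x Ψ n ≈ᴹ fold x G u

    Fixed : Pred Carrierᴹ ℓm
    Fixed x = (Ψ x ≈ᴹ x) × (G x ≈ᴹ x)

    private
      exponents = bézout-mod u n t coprime
      α = proj₁ exponents
      β = proj₁ (proj₂ exponents)
      k = proj₁ (proj₂ (proj₂ exponents))
      bézout = proj₂ (proj₂ (proj₂ exponents))

      H : Carrierᴹ → Carrierᴹ
      H = Ψ^ α G^ β

      H-semilinear : Semilinear 1 H
      H-semilinear = degree-cong
        (λ a → trans (reflexive (≡.cong (λ e → Fr e a) bézout)) (Fr-period 1 k a))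
        (∘-semilinear (fold-semilinear Ψ-semilinear α) (fold-semilinear G-semilinear β))

      Fixed⇒W : ∀ {x} → Fixed x → W x
      Fixed⇒W (Ψx≈x , Gx≈x) = ≈ᴹ-trans (fold-fixed (cong Ψ-semilinear) Ψx≈x n)
                                       (≈ᴹ-sym (fold-fixed (cong G-semilinear) Gx≈x u))

      Fixed⇒H-fixed : ∀ {x} → Fixed x → H x ≈ᴹ x
      Fixed⇒H-fixed (Ψx≈x , Gx≈x) = ≈ᴹ-trans (fold-cong (cong Ψ-semilinear) α (fold-fixed (cong G-semilinear) Gx≈x β))
                                             (fold-fixed (cong Ψ-semilinear) Ψx≈x α)

      H-fixed⇒Fixed : ∀ {x} → W x → H x ≈ᴹ x → Fixed x
      H-fixed⇒Fixed {x} Wx Hx≈x =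
        ≈ᴹ-trans (≈ᴹ-sym (H^u≈Ψ {n} {t} {u} G^t≈id Wx {α} {β} {k} bézout)) (fold-fixed (cong H-semilinear) Hx≈x u) ,
        ≈ᴹ-trans (≈ᴹ-sym (H^n≈G {n} {t} {u} G^t≈id Wx {α} {β} {k} bézout)) (fold-fixed (cong H-semilinear) Hx≈x n)

      Ψ^n-semilinear : Semilinear (n ℕ.* u) (λ x → fold x Ψ n)
      Ψ^n-semilinear = fold-semilinear Ψ-semilinear n

      G^u-semilinear : Semilinear (n ℕ.* u) (λ x → fold x G u)
      G^u-semilinear = degree-cong (λ a → reflexive (≡.cong (λ e → Fr e a) (ℕ.*-comm u n)))
                                   (fold-semilinear G-semilinear u)

      -- Both sides of the equation defining `W` are semilinear of the same degree `n * u`, which is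
      -- why `W` is a subspace over `K`.
      W-* : ∀ a {x} → W x → W (a *ₗ x)
      W-* a Wx = ≈ᴹ-trans (homo-* Ψ^n-semilinear a _)
        (≈ᴹ-trans (*ₗ-congˡ Wx) (≈ᴹ-sym (homo-* G^u-semilinear a _)))

      W-sum : ∀ {k} (x : Vector Carrierᴹ k) → (∀ i → W (x i)) → W (∑.sum x)
      W-sum {k} x Wx = ≈ᴹ-trans (homo-sum Ψ^n-semilinear x)
        (≈ᴹ-trans (∑.sum-cong-≋ {k} Wx) (≈ᴹ-sym (homo-sum G^u-semilinear x)))

      W-H : ∀ {x} → W x → W (H x)
      W-H {x} Wx = begin
        (Ψ^ n G^ 0) (H x)            ≈⟨ Ψ^G^-∘ n 0 α β x ⟩
        (Ψ^ (n ℕ.+ α) G^ β) x        ≈⟨ Ψ^G^-index x (ℕ.+-comm n α) (≡.sym (ℕ.+-identityʳ β)) ⟩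
        (Ψ^ (α ℕ.+ n) G^ (β ℕ.+ 0)) x ≈⟨ Ψ^G^-∘ α β n 0 x ⟨
        H (fold x Ψ n)               ≈⟨ cong H-semilinear Wx ⟩
        H ((Ψ^ 0 G^ u) x)            ≈⟨ Ψ^G^-∘ α β 0 u x ⟩
        (Ψ^ (α ℕ.+ 0) G^ (β ℕ.+ u)) x ≈⟨ Ψ^G^-index x (ℕ.+-identityʳ α) (ℕ.+-comm β u) ⟩
        (Ψ^ α G^ (u ℕ.+ β)) x        ≈⟨ Ψ^G^-∘ 0 u α β x ⟨
        fold (H x) G u               ∎

      W-H^ : ∀ {x} → W x → ∀ i → W (fold x H i)
      W-H^ Wx zero    = Wx
      W-H^ Wx (suc i) = W-H (W-H^ Wx i)

      trace-Fixed : ∀ {x} → W x → Fixed (trace H x)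
      trace-Fixed {x} Wx = H-fixed⇒Fixed (W-sum {n ℕ.* t} (λ i → fold x H (toℕ i)) λ i → W-H^ Wx (toℕ i))
        (trace-fixed H-semilinear (H^nt≈id {n} {t} {u} G^t≈id Wx {α} {β} {k} bézout))

    module _ {d : ℕ} (v : Vector Carrierᴹ d) (v-fixed : ∀ i → Fixed (v i)) where

      -- Applying the trace of H to a (Σ γᵢ vᵢ) = 0 gives Σ Tr(a γᵢ) vᵢ = 0, whose
      -- coefficients lie in the subfield and hence vanish, for every a.
      independent-over-subfield⇒independent :
        (∀ a → combination (ι ∘ a) v ≈ᴹ 0ᴹ → ∀ i → a i F.≈ F.0#) → LinearlyIndependent v
      independent-over-subfield⇒independent independent γ γv≈0 i =
        Unit.traces≈0⇒≈0 Fr-semilinear (γ i) traces≈0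
        where
        H-combination : ∀ (δ : Vector Carrier d) j →
                        fold (combination δ v) H j ≈ᴹ combination (λ i → fold (δ i) (Fr 1) j) v
        H-combination δ j = ≈ᴹ-trans (homo-combination (fold-semilinear H-semilinear j) δ v)
          (combination-cong {d}
            (λ i → sym (fold-Fr 1 (δ i) j))
            (λ i → fold-fixed (cong H-semilinear) (Fixed⇒H-fixed (v-fixed i)) j))

        module _ (a : Carrier) where
          δ : Vector Carrier d
          δ i = a * γ i

          fixed-trace : ∀ i → ∃[ z ] Unit.trace (Fr 1) (δ i) ≈ ι z
          fixed-trace i = fixed⇒ι _ (Unit.trace-fixed Fr-semilinear (trans (fold-Fr 1 (δ i) (n ℕ.* t))
            (trans (reflexive (≡.cong (λ e → Fr e (δ i)) (ℕ.*-identityʳ (n ℕ.* t)))) (Fr-period′ (δ i)))))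
            where
            Fr-period′ : ∀ x → Fr (n ℕ.* t) x ≈ x
            Fr-period′ x = trans (reflexive (≡.cong (λ e → Fr e x) (≡.sym (ℕ.*-identityʳ (n ℕ.* t)))))
              (trans (Fr-period 0 1 x) (Fr-zero x))

          z : Vector F.Carrier d
          z i = proj₁ (fixed-trace i)

          combination-traces≈0 : combination (ι ∘ z) v ≈ᴹ 0ᴹ
          combination-traces≈0 = begin
            combination (ι ∘ z) v
              ≈⟨ combination-congʳ {v = v} (λ i → proj₂ (fixed-trace i)) ⟨
            combination (λ i → Unit.trace (Fr 1) (δ i)) v
              ≈⟨ ∑.sum-cong-≋ {d} (λ i → *ₗ-distribʳ-sum {n ℕ.* t} (λ j → fold (δ i) (Fr 1) (toℕ j)) (v i)) ⟩
            ∑.sum (λ i → ∑.sum {n ℕ.* t} (λ j → fold (δ i) (Fr 1) (toℕ j) *ₗ v i))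
              ≈⟨ ∑.∑-comm {d} {n ℕ.* t} (λ i j → fold (δ i) (Fr 1) (toℕ j) *ₗ v i) ⟩
            ∑.sum {n ℕ.* t} (λ j → combination (λ i → fold (δ i) (Fr 1) (toℕ j)) v)
              ≈⟨ ∑.sum-cong-≋ {n ℕ.* t} (λ j → H-combination δ (toℕ j)) ⟨
            trace H (combination δ v)
              ≈⟨ trace-cong H-semilinear (≈ᴹ-trans (combination-* a γ v) (≈ᴹ-trans (*ₗ-congˡ γv≈0) (*ₗ-zeroʳ a))) ⟩
            trace H 0ᴹ
              ≈⟨ ≈ᴹ-trans (∑.sum-cong-≋ {n ℕ.* t} λ j → homo-0 (fold-semilinear H-semilinear (toℕ j)))
                          (∑.sum-replicate-zero (n ℕ.* t)) ⟩
            0ᴹ ∎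

        traces≈0 : ∀ a → Unit.trace (Fr 1) (a * γ i) ≈ 0#
        traces≈0 a = trans (proj₂ (fixed-trace a i)) (trans
          (IsRingHomomorphism.⟦⟧-cong hom (independent (z a) (combination-traces≈0 a) i))
          (IsRingHomomorphism.0#-homo hom))

      -- For `x` in `W` all multiples `a *ₗ x` stay in `W`, so their traces are fixed vectors and
      -- lie in the span of `v`; hence so does `x`.
      subfield-basis⇒basis :
        (∀ a → combination (ι ∘ a) v ≈ᴹ 0ᴹ → ∀ i → a i F.≈ F.0#) →
        (∀ x → Fixed x → ∃[ a ] x ≈ᴹ combination (ι ∘ a) v) →
        IsBasis W v
      subfield-basis⇒basis independent spanning =
        (λ i → Fixed⇒W (v-fixed i)) ,
        independent-over-subfield⇒independent independent ,
        λ x Wx → traces∈span⇒∈span H-semilinear {v = v} x λ a →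
          let b , eq = spanning (trace H (a *ₗ x)) (trace-Fixed (W-* a Wx)) in ι ∘ b , eq

-- The linearized polynomial and its matrix

module _ {t : ℕ} .{{_ : NonZero t}} where

  toℕ-mod : ∀ a → toℕ (a mod t) ≡ a % t
  toℕ-mod a = Fin.toℕ-fromℕ< (m%n<n a t)

  mod-cong : ∀ {a b} → a % t ≡ b % t → a mod t ≡ b mod t
  mod-cong {a} {b} eq = Fin.toℕ-injective (≡.trans (toℕ-mod a) (≡.trans eq (≡.sym (toℕ-mod b))))

  toℕ-mod-id : ∀ (i : Fin t) → toℕ i mod t ≡ i
  toℕ-mod-id i = Fin.toℕ-injective (≡.trans (toℕ-mod (toℕ i)) (m<n⇒m%n≡m (Fin.toℕ<n i)))

  %-+ˡ : ∀ a b → (a % t ℕ.+ b) % t ≡ (a ℕ.+ b) % t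
  %-+ˡ a b = ≡.trans (%-distribˡ-+ (a % t) b t)
    (≡.trans (≡.cong (λ r → (r ℕ.+ b % t) % t) (m%n%n≡m%n a t)) (≡.sym (%-distribˡ-+ a b t)))

  mod-+ˡ : ∀ a b → (toℕ (a mod t) ℕ.+ b) mod t ≡ (a ℕ.+ b) mod t
  mod-+ˡ a b = mod-cong (≡.trans (≡.cong (λ r → (r ℕ.+ b) % t) (toℕ-mod a)) (%-+ˡ a b))

  mod-+ʳ : ∀ a b → (a ℕ.+ toℕ (b mod t)) mod t ≡ (a ℕ.+ b) mod t
  mod-+ʳ a b = ≡.trans (≡.cong (_mod t) (ℕ.+-comm a _))
    (≡.trans (mod-+ˡ b a) (≡.cong (_mod t) (ℕ.+-comm b a)))

  [a+kt]mod : ∀ a k → (a ℕ.+ k ℕ.* t) mod t ≡ a mod t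
  [a+kt]mod a k = mod-cong ([m+kn]%n≡m%n a k t)

  wrap : ∀ {a} (k : Fin t) → a ≡ toℕ k ℕ.+ t → a mod t ≡ k
  wrap k ≡.refl = ≡.trans (mod-cong ([m+n]%n≡m%n (toℕ k) t)) (toℕ-mod-id k)

  -- Adding `pred t` is subtraction of 1 modulo `t`, free of truncation.
  suc-pred-mod : ∀ a → suc (toℕ ((a ℕ.+ ℕ.pred t) mod t)) % t ≡ a % t
  suc-pred-mod a = begin
    suc (toℕ ((a ℕ.+ ℕ.pred t) mod t)) % t    ≡⟨ ≡.cong (_% t) (ℕ.+-comm 1 (toℕ ((a ℕ.+ ℕ.pred t) mod t))) ⟩
    (toℕ ((a ℕ.+ ℕ.pred t) mod t) ℕ.+ 1) % t  ≡⟨ ≡.cong (λ r → (r ℕ.+ 1) % t) (toℕ-mod (a ℕ.+ ℕ.pred t)) ⟩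
    ((a ℕ.+ ℕ.pred t) % t ℕ.+ 1) % t          ≡⟨ %-+ˡ (a ℕ.+ ℕ.pred t) 1 ⟩
    (a ℕ.+ ℕ.pred t ℕ.+ 1) % t                ≡⟨ ≡.cong (_% t) (ℕ.+-assoc a (ℕ.pred t) 1) ⟩
    (a ℕ.+ (ℕ.pred t ℕ.+ 1)) % t              ≡⟨ ≡.cong (λ r → (a ℕ.+ r) % t) (ℕ.+-comm (ℕ.pred t) 1) ⟩
    (a ℕ.+ suc (ℕ.pred t)) % t                ≡⟨ ≡.cong (λ r → (a ℕ.+ r) % t) (ℕ.suc-pred t) ⟩
    (a ℕ.+ t) % t                             ≡⟨ [m+n]%n≡m%n a t ⟩
    a % t                                     ∎
    where open ≡.≡-Reasoning

  -- The index of `b` in row `i` of `D`, as a permutation of the columns; its inverse is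
  -- `k ↦ i + k`.
  cyclic : Fin t → Permutation t t
  cyclic i = permutation (λ j → (toℕ j ℕ.+ (t ∸ toℕ i)) mod t) (λ k → (toℕ i ℕ.+ toℕ k) mod t)
    (λ k → ≡.trans (mod-+ˡ (toℕ i ℕ.+ toℕ k) (t ∸ toℕ i)) (wrap k (begin
      toℕ i ℕ.+ toℕ k ℕ.+ (t ∸ toℕ i)    ≡⟨ ≡.cong (ℕ._+ (t ∸ toℕ i)) (ℕ.+-comm (toℕ i) (toℕ k)) ⟩
      toℕ k ℕ.+ toℕ i ℕ.+ (t ∸ toℕ i)    ≡⟨ ℕ.+-assoc (toℕ k) _ _ ⟩
      toℕ k ℕ.+ (toℕ i ℕ.+ (t ∸ toℕ i))  ≡⟨ ≡.cong (toℕ k ℕ.+_) (ℕ.m+[n∸m]≡n i≤t) ⟩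
      toℕ k ℕ.+ t                        ∎)))
    (λ j → ≡.trans (mod-+ʳ (toℕ i) (toℕ j ℕ.+ (t ∸ toℕ i))) (wrap j (begin
      toℕ i ℕ.+ (toℕ j ℕ.+ (t ∸ toℕ i))  ≡⟨ ℕ.+-comm (toℕ i) _ ⟩
      toℕ j ℕ.+ (t ∸ toℕ i) ℕ.+ toℕ i    ≡⟨ ℕ.+-assoc (toℕ j) _ _ ⟩
      toℕ j ℕ.+ (t ∸ toℕ i ℕ.+ toℕ i)    ≡⟨ ≡.cong (toℕ j ℕ.+_) (ℕ.m∸n+n≡m i≤t) ⟩
      toℕ j ℕ.+ t                        ∎)))
    where
    open ≡.≡-Reasoning
    i≤t = ℕ.<⇒≤ (Fin.toℕ<n i)

module LinearizedMatrix
  (𝕂 : HeytingField c ℓ₁ ℓ₂) (q n t u : ℕ) .{{_ : NonZero n}} .{{_ : NonZero t}} .{{_ : NonZero u}}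
  (q-primePower : IsPrimePower q)
  (order : HasOrder (fieldRing 𝕂) (q ℕ.^ (n ℕ.* t)))
  (b : Vector (CommutativeRing.Carrier (fieldRing 𝕂)) t)
  where
  private instance
    nt≢0 : NonZero (n ℕ.* t)
    nt≢0 = ℕ.m*n≢0 n t
  open CommutativeRing (fieldRing 𝕂) hiding (zero)
  open Frobenius 𝕂 {q} {n ℕ.* t} q-primePower order
  open Linearized (fieldRing 𝕂) q n t u
  open Matrices (fieldRing 𝕂)
  open MatrixAction (fieldRing 𝕂)
  open SemiringSum semiring
  open RingProperties ring using (x∙y⁻¹≈ε⇒x≈y)
  open Semilinearity (coordinateSpace t) using (Semilinear)
  module V = LeftModule (coordinateSpace t)
  open SetoidReasoning setoid

  Fr-index : ∀ {d e} → d ≡ e → ∀ x → Fr d x ≈ Fr e x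
  Fr-index ≡.refl x = refl

  J-⊛ : ∀ Y i → (J ⊛ Y) i ≈ Y (suc (toℕ i) mod t)
  J-⊛ Y i = indicator-sum (λ j → toℕ j ℕ.≟ suc (toℕ i) % t) Y (suc (toℕ i) mod t) (toℕ-mod (suc (toℕ i)))
    λ j eq → Fin.toℕ-injective (≡.trans eq (≡.sym (toℕ-mod (suc (toℕ i)))))

  J^-⊛ : ∀ s Y i → (J ^ᴹ s ⊛ Y) i ≈ Y ((toℕ i ℕ.+ s) mod t)
  J^-⊛ zero    Y i = trans (identity-⊛ Y i) (reflexive (≡.cong Y
    (≡.sym (≡.trans (≡.cong (_mod t) (ℕ.+-identityʳ (toℕ i))) (toℕ-mod-id i)))))
  J^-⊛ (suc s) Y i = begin
    ((J · J ^ᴹ s) ⊛ Y) i                      ≈⟨ ·-⊛ J (J ^ᴹ s) Y i ⟩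
    (J ⊛ J ^ᴹ s ⊛ Y) i                        ≈⟨ J-⊛ (J ^ᴹ s ⊛ Y) i ⟩
    (J ^ᴹ s ⊛ Y) (suc (toℕ i) mod t)          ≈⟨ J^-⊛ s Y _ ⟩
    Y ((toℕ (suc (toℕ i) mod t) ℕ.+ s) mod t)
      ≡⟨ ≡.cong Y (≡.trans (mod-+ˡ (suc (toℕ i)) s) (≡.cong (_mod t) (≡.sym (ℕ.+-suc (toℕ i) s)))) ⟩
    Y ((toℕ i ℕ.+ suc s) mod t)               ∎

  -- Substituting `j = i + k` puts `b k` in the same place in every row, as in the polynomial `f`.
  D-⊛ : ∀ Y i → (D b ⊛ Y) i ≈ sum (λ k → Fr (n ℕ.* toℕ i) (b k) * Y ((toℕ i ℕ.+ toℕ k) mod t))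
  D-⊛ Y i = sym (trans (sum-permute _ (cyclic i)) (sum-cong-≋ {t} λ j →
    *-congˡ (reflexive (≡.cong Y (Perm.inverseˡ (cyclic i))))))

  -- The shift in `G` goes backwards, so that a vector fixed by `G` has each entry equal to the
  -- q^n-th power of the preceding one.
  Ψ G : Vector Carrier t → Vector Carrier t
  Ψ Y i = Fr u ((D b ⊛ Y) i)
  G Y i = Fr n (Y ((toℕ i ℕ.+ ℕ.pred t) mod t))

  Ψ-semilinear : Semilinear u Ψ
  Ψ-semilinear = record
    { cong = λ x≈y i → Fr-cong u (⊛-cong (D b) x≈y i)
    ; homo-+ = λ x y i → trans (Fr-cong u (⊛-homo-+ (D b) x y i)) (Fr-homo-+ u _ _)
    ; homo-* = λ a x i → trans (Fr-cong u (⊛-homo-* (D b) a x i)) (Fr-homo-* u _ _)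
    }

  G-semilinear : Semilinear n G
  G-semilinear = record
    { cong = λ x≈y i → Fr-cong n (x≈y _)
    ; homo-+ = λ x y i → Fr-homo-+ n _ _
    ; homo-* = λ a x i → Fr-homo-* n _ _
    }

  Fr-n*-mod : ∀ {d e} → d % t ≡ e % t → ∀ x → Fr (n ℕ.* d) x ≈ Fr (n ℕ.* e) x
  Fr-n*-mod {d} {e} eq x = trans (reduce d) (trans (Fr-index (≡.cong (n ℕ.*_) eq) x) (sym (reduce e)))
    where
    expand : ∀ n t r k → n ℕ.* (r ℕ.+ k ℕ.* t) ≡ n ℕ.* r ℕ.+ n ℕ.* t ℕ.* k
    expand = solve-∀

    reduce : ∀ d → Fr (n ℕ.* d) x ≈ Fr (n ℕ.* (d % t)) x
    reduce d = trans
      (Fr-index (≡.trans (≡.cong (n ℕ.*_) (m≡m%n+[m/n]*n d t)) (expand n t (d % t) (d / t))) x)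
      (Fr-period (n ℕ.* (d % t)) (d / t) x)

  -- Each row of `D` is the preceding one shifted cyclically and raised to the power q^n. This holds
  -- also from the last row to the first, because `Fr (n * t)` is the identity.
  ΨG≈GΨ : ∀ Y i → Ψ (G Y) i ≈ G (Ψ Y) i
  ΨG≈GΨ Y i = sym (begin
    Fr n (Fr u ((D b ⊛ Y) i′))
      ≈⟨ Fr-comm n u _ ⟩
    Fr u (Fr n ((D b ⊛ Y) i′))
      ≈⟨ Fr-cong u (trans (Fr-cong n (D-⊛ Y i′)) (Fr-sum n {t} _)) ⟩
    Fr u (sum (λ k → Fr n (Fr (n ℕ.* toℕ i′) (b k) * Y ((toℕ i′ ℕ.+ toℕ k) mod t))))
      ≈⟨ Fr-cong u (sum-cong-≋ {t} λ k → trans (Fr-homo-* n _ _)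
           (*-cong (coefficient (b k)) (reflexive (≡.cong (Fr n ∘ Y) (position k))))) ⟩
    Fr u (sum (λ k → Fr (n ℕ.* toℕ i) (b k) * G Y ((toℕ i ℕ.+ toℕ k) mod t)))
      ≈⟨ Fr-cong u (D-⊛ (G Y) i) ⟨
    Fr u ((D b ⊛ G Y) i) ∎)
    where
    i′ = (toℕ i ℕ.+ ℕ.pred t) mod t

    coefficient : ∀ x → Fr n (Fr (n ℕ.* toℕ i′) x) ≈ Fr (n ℕ.* toℕ i) x
    coefficient x = trans (sym (Fr-+ n (n ℕ.* toℕ i′) x))
      (trans (Fr-index (≡.sym (ℕ.*-suc n (toℕ i′))) x) (Fr-n*-mod (suc-pred-mod (toℕ i)) x))

    position : ∀ k → (toℕ i′ ℕ.+ toℕ k) mod t ≡ (toℕ ((toℕ i ℕ.+ toℕ k) mod t) ℕ.+ ℕ.pred t) mod t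
    position k = ≡.trans (mod-+ˡ (toℕ i ℕ.+ ℕ.pred t) (toℕ k))
      (≡.trans (≡.cong (_mod t) (swap (toℕ i) (ℕ.pred t) (toℕ k))) (≡.sym (mod-+ˡ (toℕ i ℕ.+ toℕ k) (ℕ.pred t))))
      where
      swap : ∀ a b c → a ℕ.+ b ℕ.+ c ≡ a ℕ.+ c ℕ.+ b
      swap = solve-∀

  fold-G : ∀ e Y i → fold Y G e i ≈ Fr (n ℕ.* e) (Y ((toℕ i ℕ.+ e ℕ.* ℕ.pred t) mod t))
  fold-G zero    Y i = sym (trans (Fr-index (ℕ.*-zeroʳ n) _) (trans (Fr-zero _) (reflexive (≡.cong Y
    (≡.trans (≡.cong (_mod t) (ℕ.+-identityʳ (toℕ i))) (toℕ-mod-id i))))))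
  fold-G (suc e) Y i = begin
    Fr n (fold Y G e i′)
      ≈⟨ Fr-cong n (fold-G e Y i′) ⟩
    Fr n (Fr (n ℕ.* e) (Y ((toℕ i′ ℕ.+ e ℕ.* ℕ.pred t) mod t)))
      ≈⟨ Fr-+ n (n ℕ.* e) _ ⟨
    Fr (n ℕ.+ n ℕ.* e) (Y ((toℕ i′ ℕ.+ e ℕ.* ℕ.pred t) mod t))
      ≈⟨ Fr-index (≡.sym (ℕ.*-suc n e)) _ ⟩
    Fr (n ℕ.* suc e) (Y ((toℕ i′ ℕ.+ e ℕ.* ℕ.pred t) mod t))
      ≡⟨ ≡.cong (Fr (n ℕ.* suc e) ∘ Y) (≡.trans (mod-+ˡ (toℕ i ℕ.+ ℕ.pred t) (e ℕ.* ℕ.pred t))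
                                                (≡.cong (_mod t) (ℕ.+-assoc (toℕ i) _ _))) ⟩
    Fr (n ℕ.* suc e) (Y ((toℕ i ℕ.+ suc e ℕ.* ℕ.pred t) mod t)) ∎
    where i′ = (toℕ i ℕ.+ ℕ.pred t) mod t

  G^t≈id : ∀ Y i → fold Y G t i ≈ Y i
  G^t≈id Y i = begin
    fold Y G t i
      ≈⟨ fold-G t Y i ⟩
    Fr (n ℕ.* t) (Y ((toℕ i ℕ.+ t ℕ.* ℕ.pred t) mod t))
      ≈⟨ Fr-n*-mod {t} {0} (≡.trans (n%n≡0 t) (≡.sym (m<n⇒m%n≡m (ℕ.>-nonZero⁻¹ t)))) _ ⟩
    Fr (n ℕ.* 0) (Y ((toℕ i ℕ.+ t ℕ.* ℕ.pred t) mod t))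
      ≈⟨ trans (Fr-index (ℕ.*-zeroʳ n) _) (Fr-zero _) ⟩
    Y ((toℕ i ℕ.+ t ℕ.* ℕ.pred t) mod t)
      ≡⟨ ≡.cong Y (≡.trans (≡.cong (λ r → (toℕ i ℕ.+ r) mod t) (ℕ.*-comm t (ℕ.pred t)))
           (≡.trans ([a+kt]mod (toℕ i) (ℕ.pred t)) (toℕ-mod-id i))) ⟩
    Y i ∎

  -- The null space of the matrix and the roots of f

  module Kernel (τ : Carrier → Carrier) (τ-inverse : IsInverseOfσ τ) (s : ℕ) (τ≈Fr-s : ∀ x → τ x ≈ Fr s x) where

    -- `σ` after `τ` is both `Fr (u + s)` and the identity.
    nt∣u+s : n ℕ.* t ∣ u ℕ.+ s
    nt∣u+s = Fr-trivial⇒∣ (u ℕ.+ s) λ x → trans (Fr-+ u s x) (proj₁ τ-inverse (sym (τ≈Fr-s x)))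

    Fr-iterate-τ : ∀ e x → Fr (e ℕ.* u) (iterate τ x e) ≈ x
    Fr-iterate-τ zero    x = Fr-zero x
    Fr-iterate-τ (suc e) x = begin
      Fr (u ℕ.+ e ℕ.* u) (iterate τ (τ x) e)      ≈⟨ Fr-+ u (e ℕ.* u) _ ⟩
      Fr u (Fr (e ℕ.* u) (iterate τ (τ x) e))     ≈⟨ Fr-cong u (Fr-iterate-τ e (τ x)) ⟩
      Fr u (τ x)                                ≈⟨ proj₁ τ-inverse refl ⟩
      x                                         ∎

    -- Raising to σ^(e + 1) cancels the τ^e on the leading factor up to one `σ`, which together with
    -- `D` makes the next `Ψ`; the remaining factors receive σ^e, as the induction requires.
    Fr-twistedProduct : ∀ e Y i → Fr (e ℕ.* u) ((twistedProduct τ (D b) e ⊛ Y) i) ≈ fold Y Ψ e i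
    Fr-twistedProduct zero    Y i = trans (Fr-zero _) (identity-⊛ Y i)
    Fr-twistedProduct (suc e) Y i = begin
      Fr (u ℕ.+ e ℕ.* u) (((applyEntrywise (λ x → iterate τ x e) (D b) · P) ⊛ Y) i)
        ≈⟨ Fr-+ u (e ℕ.* u) _ ⟩
      Fr u (Fr (e ℕ.* u) (((applyEntrywise (λ x → iterate τ x e) (D b) · P) ⊛ Y) i))
        ≈⟨ Fr-cong u (trans (Fr-cong (e ℕ.* u) (·-⊛ (applyEntrywise (λ x → iterate τ x e) (D b)) P Y i))
                            (Fr-sum (e ℕ.* u) {t} _)) ⟩
      Fr u (sum (λ j → Fr (e ℕ.* u) (iterate τ (D b i j) e * (P ⊛ Y) j)))
        ≈⟨ Fr-cong u (sum-cong-≋ {t} λ j → trans (Fr-homo-* (e ℕ.* u) _ _)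
             (*-cong (Fr-iterate-τ e (D b i j)) (Fr-twistedProduct e Y j))) ⟩
      Fr u ((D b ⊛ fold Y Ψ e) i) ∎
      where P = twistedProduct τ (D b) e

    -- J^s shifts by `s` and G^u by `- u`; these agree modulo `t` since `n * t` divides `u + s`.
    Fr-J^ : ∀ Y i → Fr (n ℕ.* u) ((J ^ᴹ s ⊛ Y) i) ≈ fold Y G u i
    Fr-J^ Y i = trans (Fr-cong (n ℕ.* u) (trans (J^-⊛ s Y i) (reflexive (≡.cong Y index)))) (sym (fold-G u Y i))
      where
      k = quotient nt∣u+s

      regroup₁ : ∀ i s u t′ → i ℕ.+ s ℕ.+ u ℕ.* suc t′ ≡ i ℕ.+ u ℕ.* t′ ℕ.+ (u ℕ.+ s)
      regroup₁ = solve-∀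
      regroup₂ : ∀ a k n t → a ℕ.+ k ℕ.* (n ℕ.* t) ≡ a ℕ.+ (k ℕ.* n) ℕ.* t
      regroup₂ = solve-∀

      index : (toℕ i ℕ.+ s) mod t ≡ (toℕ i ℕ.+ u ℕ.* ℕ.pred t) mod t
      index = ≡.trans (≡.sym ([a+kt]mod (toℕ i ℕ.+ s) u)) (≡.trans (≡.cong (_mod t)
        (≡.trans (≡.cong (λ t → toℕ i ℕ.+ s ℕ.+ u ℕ.* t) (≡.sym (ℕ.suc-pred t)))
          (≡.trans (regroup₁ (toℕ i) s u (ℕ.pred t))
            (≡.trans (≡.cong (toℕ i ℕ.+ u ℕ.* ℕ.pred t ℕ.+_) (_∣_.equality nt∣u+s))
              (regroup₂ (toℕ i ℕ.+ u ℕ.* ℕ.pred t) k n t)))))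
        ([a+kt]mod (toℕ i ℕ.+ u ℕ.* ℕ.pred t) (k ℕ.* n)))

    N : Matrix t t
    N = twistedProduct τ (D b) n ⊖ J ^ᴹ s

    null⇒ : ∀ {Y} → Null N Y → fold Y Ψ n V.≈ᴹ fold Y G u
    null⇒ {Y} null i = begin
      fold Y Ψ n i                                       ≈⟨ Fr-twistedProduct n Y i ⟨
      Fr (n ℕ.* u) ((twistedProduct τ (D b) n ⊛ Y) i)    ≈⟨ Fr-cong (n ℕ.* u) equal ⟩
      Fr (n ℕ.* u) ((J ^ᴹ s ⊛ Y) i)                      ≈⟨ Fr-J^ Y i ⟩
      fold Y G u i                                       ∎
      where
      equal : (twistedProduct τ (D b) n ⊛ Y) i ≈ (J ^ᴹ s ⊛ Y) i
      equal = x∙y⁻¹≈ε⇒x≈y _ _ (trans (sym (⊖-⊛ (twistedProduct τ (D b) n) (J ^ᴹ s) Y i)) (null i))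

    ⇒null : ∀ {Y} → fold Y Ψ n V.≈ᴹ fold Y G u → Null N Y
    ⇒null {Y} eq i = trans (⊖-⊛ (twistedProduct τ (D b) n) (J ^ᴹ s) Y i)
      (trans (+-congʳ (Fr-injective (n ℕ.* u) (trans (Fr-twistedProduct n Y i) (trans (eq i) (sym (Fr-J^ Y i))))))
             (-‿inverseʳ _))

    conjugates : Carrier → Vector Carrier t
    conjugates x j = Fr (u ℕ.+ n ℕ.* toℕ j) x

    conjugates-G : ∀ x j → G (conjugates x) j ≈ conjugates x j
    conjugates-G x j = begin
      Fr n (Fr (u ℕ.+ n ℕ.* toℕ j′) x)    ≈⟨ Fr-+ n (u ℕ.+ n ℕ.* toℕ j′) x ⟨
      Fr (n ℕ.+ (u ℕ.+ n ℕ.* toℕ j′)) x   ≈⟨ Fr-index (regroup n u (toℕ j′)) x ⟩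
      Fr (u ℕ.+ n ℕ.* suc (toℕ j′)) x     ≈⟨ Fr-+ u (n ℕ.* suc (toℕ j′)) x ⟩
      Fr u (Fr (n ℕ.* suc (toℕ j′)) x)    ≈⟨ Fr-cong u (Fr-n*-mod (suc-pred-mod (toℕ j)) x) ⟩
      Fr u (Fr (n ℕ.* toℕ j) x)           ≈⟨ Fr-+ u (n ℕ.* toℕ j) x ⟨
      Fr (u ℕ.+ n ℕ.* toℕ j) x            ∎
      where
      j′ = (toℕ j ℕ.+ ℕ.pred t) mod t
      regroup : ∀ n u a → n ℕ.+ (u ℕ.+ n ℕ.* a) ≡ u ℕ.+ n ℕ.* suc a
      regroup = solve-∀

    -- The inner sum is `f b x + x`. All `t` coordinates are conjugates of this one element, so a
    -- single equation over `K` decides whether `Ψ` fixes the vector.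
    conjugates-Ψ : ∀ x j → Ψ (conjugates x) j ≈
                           Fr (u ℕ.+ n ℕ.* toℕ j) (sum (λ i → b i * Fr (u ℕ.+ n ℕ.* toℕ i) x))
    conjugates-Ψ x j = begin
      Fr u ((D b ⊛ conjugates x) j)
        ≈⟨ Fr-cong u (D-⊛ (conjugates x) j) ⟩
      Fr u (sum (λ k → Fr (n ℕ.* toℕ j) (b k) * Fr (u ℕ.+ n ℕ.* toℕ ((toℕ j ℕ.+ toℕ k) mod t)) x))
        ≈⟨ Fr-cong u (trans (Fr-sum (n ℕ.* toℕ j) {t} _) (sum-cong-≋ {t} λ k →
             trans (Fr-homo-* (n ℕ.* toℕ j) _ _) (*-congˡ (position k)))) ⟨
      Fr u (Fr (n ℕ.* toℕ j) (sum (λ i → b i * Fr (u ℕ.+ n ℕ.* toℕ i) x)))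
        ≈⟨ Fr-+ u (n ℕ.* toℕ j) _ ⟨
      Fr (u ℕ.+ n ℕ.* toℕ j) (sum (λ i → b i * Fr (u ℕ.+ n ℕ.* toℕ i) x)) ∎
      where
      regroup : ∀ n u j k → n ℕ.* j ℕ.+ (u ℕ.+ n ℕ.* k) ≡ u ℕ.+ n ℕ.* (j ℕ.+ k)
      regroup = solve-∀
      position : ∀ k → Fr (n ℕ.* toℕ j) (Fr (u ℕ.+ n ℕ.* toℕ k) x) ≈
                       Fr (u ℕ.+ n ℕ.* toℕ ((toℕ j ℕ.+ toℕ k) mod t)) x
      position k = begin
        Fr (n ℕ.* toℕ j) (Fr (u ℕ.+ n ℕ.* toℕ k) x)                ≈⟨ Fr-+ (n ℕ.* toℕ j) _ x ⟨
        Fr (n ℕ.* toℕ j ℕ.+ (u ℕ.+ n ℕ.* toℕ k)) x                 ≈⟨ Fr-index (regroup n u (toℕ j) (toℕ k)) x ⟩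
        Fr (u ℕ.+ n ℕ.* (toℕ j ℕ.+ toℕ k)) x                     ≈⟨ Fr-+ u _ x ⟩
        Fr u (Fr (n ℕ.* (toℕ j ℕ.+ toℕ k)) x)
          ≈⟨ Fr-cong u (Fr-n*-mod (≡.trans (≡.sym (m%n%n≡m%n (toℕ j ℕ.+ toℕ k) t))
                                           (≡.cong (_% t) (≡.sym (toℕ-mod (toℕ j ℕ.+ toℕ k))))) x) ⟩
        Fr u (Fr (n ℕ.* toℕ ((toℕ j ℕ.+ toℕ k) mod t)) x)        ≈⟨ Fr-+ u _ x ⟨
        Fr (u ℕ.+ n ℕ.* toℕ ((toℕ j ℕ.+ toℕ k) mod t)) x         ∎

    Ker⇒sum≈ : ∀ {x} → Ker b x → sum (λ i → b i * Fr (u ℕ.+ n ℕ.* toℕ i) x) ≈ x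
    Ker⇒sum≈ fx≈0 = x∙y⁻¹≈ε⇒x≈y _ _ (trans (+-comm _ _) fx≈0)

    sum≈⇒Ker : ∀ {x} → sum (λ i → b i * Fr (u ℕ.+ n ℕ.* toℕ i) x) ≈ x → Ker b x
    sum≈⇒Ker eq = trans (+-congˡ eq) (-‿inverseˡ _)

    Ker⇒conjugates-fixed : ∀ {x} → Ker b x →
      (Ψ (conjugates x) V.≈ᴹ conjugates x) × (G (conjugates x) V.≈ᴹ conjugates x)
    Ker⇒conjugates-fixed {x} fx≈0 =
      (λ j → trans (conjugates-Ψ x j) (Fr-cong (u ℕ.+ n ℕ.* toℕ j) (Ker⇒sum≈ fx≈0))) , conjugates-G x

    -- Applying `G` as many times as the index says carries entry 0 to any place, so `Y` is
    -- determined by that entry. Taking `τ` of it yields the `x` whose image under `σ` is the entry.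
    fixed⇒conjugates : ∀ {Y} → Ψ Y V.≈ᴹ Y → G Y V.≈ᴹ Y → ∃[ x ] (Ker b x × Y V.≈ᴹ conjugates x)
    fixed⇒conjugates {Y} ΨY≈Y GY≈Y = x , sum≈⇒Ker (Fr-injective (u ℕ.+ n ℕ.* toℕ 0F) (begin
        Fr (u ℕ.+ n ℕ.* toℕ 0F) (sum (λ i → b i * Fr (u ℕ.+ n ℕ.* toℕ i) x))  ≈⟨ conjugates-Ψ x 0F ⟨
        Ψ (conjugates x) 0F     ≈⟨ Semilinear.cong Ψ-semilinear Y≈conjugates 0F ⟨
        Ψ Y 0F                  ≈⟨ ΨY≈Y 0F ⟩
        Y 0F                    ≈⟨ Y≈conjugates 0F ⟩
        conjugates x 0F         ∎)) , Y≈conjugates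
      where
      0F = 0 mod t
      x = τ (Y 0F)
      open CommutingIterates V.≈ᴹ-setoid Ψ G (Semilinear.cong Ψ-semilinear) (Semilinear.cong G-semilinear) ΨG≈GΨ
        using (fold-fixed)

      Y≈conjugates : Y V.≈ᴹ conjugates x
      Y≈conjugates j = begin
        Y j                                                           ≈⟨ fold-fixed (Semilinear.cong G-semilinear) GY≈Y (toℕ j) j ⟨
        fold Y G (toℕ j) j                                            ≈⟨ fold-G (toℕ j) Y j ⟩
        Fr (n ℕ.* toℕ j) (Y ((toℕ j ℕ.+ toℕ j ℕ.* ℕ.pred t) mod t))       ≡⟨ ≡.cong (Fr (n ℕ.* toℕ j) ∘ Y) position ⟩
        Fr (n ℕ.* toℕ j) (Y 0F)                                         ≈⟨ Fr-cong (n ℕ.* toℕ j) (proj₁ τ-inverse refl) ⟨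
        Fr (n ℕ.* toℕ j) (Fr u x)                                       ≈⟨ Fr-comm (n ℕ.* toℕ j) u x ⟩
        Fr u (Fr (n ℕ.* toℕ j) x)                                       ≈⟨ Fr-+ u (n ℕ.* toℕ j) x ⟨
        Fr (u ℕ.+ n ℕ.* toℕ j) x                                        ∎
        where
        position : (toℕ j ℕ.+ toℕ j ℕ.* ℕ.pred t) mod t ≡ 0F
        position = ≡.trans (≡.cong (_mod t) (≡.trans (≡.sym (ℕ.*-suc (toℕ j) (ℕ.pred t)))
          (≡.cong (toℕ j ℕ.*_) (ℕ.suc-pred t)))) ([a+kt]mod 0 (toℕ j))

    module _ (𝔽 : HeytingField c′ ℓ₁′ ℓ₂′) (orderF : HasOrder (fieldRing 𝔽) q) (coprime : gcd u n ≡ 1)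
      {ι : CommutativeRing.Carrier (fieldRing 𝔽) → Carrier}
      (hom : IsRingHomomorphism (CommutativeRing.rawRing (fieldRing 𝔽)) rawRing ι)
      where
      private
        module F = CommutativeRing (fieldRing 𝔽)
        K/F = restrictScalars (fieldRing 𝔽) (fieldRing 𝕂) hom
        module DF = Dimension (fieldRing 𝔽) K/F
        module DK = Dimension (fieldRing 𝕂) (coordinateSpace t)
      open FixedField 𝔽 orderF hom using (Fr-ι)

      conjugates-combination : ∀ {d} (a : Vector F.Carrier d) (x : Vector Carrier d) →
        conjugates (DF.combination a x) V.≈ᴹ DK.combination (ι ∘ a) (conjugates ∘ x)
      conjugates-combination {d} a x j = begin
        Fr e (sum (λ i → ι (a i) * x i))                   ≈⟨ Fr-sum e {d} _ ⟩
        sum (λ i → Fr e (ι (a i) * x i))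
          ≈⟨ sum-cong-≋ {d} (λ i → trans (Fr-homo-* e _ _) (*-congʳ (Fr-ι e (a i)))) ⟩
        sum (λ i → ι (a i) * conjugates (x i) j)           ≡⟨ sum-coordinate (λ i → ι (a i) V.*ₗ conjugates (x i)) j ⟨
        DK.combination (ι ∘ a) (conjugates ∘ x) j           ∎
        where e = u ℕ.+ n ℕ.* toℕ j

      -- `conjugates` is a bijection, linear over the subfield, from the roots of `f` to the vectors
      -- fixed by `Ψ` and `G`; it carries a basis to a basis, and descent makes that a basis of the
      -- null space.
      dim-Ker⇒nullity : ∀ {d} → DF.HasDimension (Ker b) d → DK.HasDimension (Null N) d
      dim-Ker⇒nullity {d} (x , x∈Ker , x-independent , Ker⊆span) =
        let W∋v , v-independent , W⊆span = subfield-basis⇒basis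
              Ψ-semilinear G-semilinear ΨG≈GΨ G^t≈id v (Ker⇒conjugates-fixed ∘ x∈Ker) independent spanning
        in v , ⇒null ∘ W∋v , v-independent , λ Y null → W⊆span Y (null⇒ null)
        where
        open Descent 𝔽 𝕂 {q} {n} {t} {u} q-primePower coprime orderF order hom (coordinateSpace t)
          using (subfield-basis⇒basis)

        v : Vector (Vector Carrier t) d
        v = conjugates ∘ x

        -- Coordinate 0 suffices, because a power of Frobenius is injective.
        independent : ∀ a → DK.combination (ι ∘ a) v V.≈ᴹ V.0ᴹ → ∀ i → a i F.≈ F.0#
        independent a eq = x-independent a (Fr-injective (u ℕ.+ n ℕ.* toℕ 0F)
          (trans (conjugates-combination a x 0F) (trans (eq 0F) (sym (Fr-0# (u ℕ.+ n ℕ.* toℕ 0F))))))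
            where 0F = 0 mod t

        spanning : ∀ Y → (Ψ Y V.≈ᴹ Y) × (G Y V.≈ᴹ Y) → ∃[ a ] Y V.≈ᴹ DK.combination (ι ∘ a) v
        spanning Y (ΨY≈Y , GY≈Y) =
          let y , y∈Ker , Y≈conj-y = fixed⇒conjugates ΨY≈Y GY≈Y
              a , y≈ = Ker⊆span y y∈Ker
          in a , λ j → trans (Y≈conj-y j) (trans (Fr-cong (u ℕ.+ n ℕ.* toℕ j) y≈) (conjugates-combination a x j))

      dim-Ker-exists : ∃[ d ] DF.HasDimension (Ker b) d
      dim-Ker-exists =
        let d , v , v∈Ker , independent , in-span =
              extract-basis _≈?_ (Ker b) (into-Ker ∘ element) (into-Ker∈Ker ∘ element)
        in d , v , v∈Ker , independent , λ x x∈Ker → span-resp {v = v}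
             (trans (into-Ker-id (Ker-resp (sym (element-index x)) x∈Ker)) (element-index x))
             (in-span (index x))
        where
        open FiniteField 𝕂 order using (_≈?_; element; index; element-index)
        open FiniteLinearAlgebra 𝔽 orderF K/F using (extract-basis)
        open Combinations (fieldRing 𝔽) K/F using (span-resp)

        Ker-resp : ∀ {x y} → x ≈ y → Ker b x → Ker b y
        Ker-resp x≈y = trans (+-cong (-‿cong (sym x≈y))
          (sum-cong-≋ {t} λ i → *-congˡ (Fr-cong (u ℕ.+ n ℕ.* toℕ i) (sym x≈y))))

        0∈Ker : Ker b 0#
        0∈Ker = sum≈⇒Ker (trans (sum-cong-≋ {t} λ i → trans (*-congˡ (Fr-0# (u ℕ.+ n ℕ.* toℕ i))) (zeroʳ (b i)))
                                (sum-replicate-zero t))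

        -- Basis extraction needs a finite family inside the kernel: every field element is listed,
        -- with non-roots replaced by the harmless `0#`.
        into-Ker : Carrier → Carrier
        into-Ker x with f b x ≈? 0#
        ... | yes _ = x
        ... | no _  = 0#

        into-Ker∈Ker : ∀ x → Ker b (into-Ker x)
        into-Ker∈Ker x with f b x ≈? 0#
        ... | yes fx≈0 = fx≈0
        ... | no _     = 0∈Ker

        into-Ker-id : ∀ {x} → Ker b x → into-Ker x ≈ x
        into-Ker-id {x} fx≈0 with f b x ≈? 0#
        ... | yes _ = refl
        ... | no fx≉0 = contradiction fx≈0 fx≉0

-- The equivalence for an integer h

open import Data.Nat.Base using (_*_; _^_)
open import Data.Integer.Base using (+_; _-_)

+r≡+[d+r]-+d : ∀ d r → + r ≡ + (d ℕ.+ r) - + d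
+r≡+[d+r]-+d d r = ≡.sym (begin
  + (d ℕ.+ r) - + d        ≡⟨ ℤ.m-n≡m⊖n (d ℕ.+ r) d ⟩
  d ℕ.+ r ℤ.⊖ d            ≡⟨ ℤ.⊖-≥ (ℕ.m≤m+n d r) ⟩
  + (d ℕ.+ r ∸ d)          ≡⟨ ≡.cong +_ (ℕ.m+n∸m≡n d r) ⟩
  + r                      ∎)
  where open ≡.≡-Reasoning

theorem1p6 :
    ∀ {c ℓ₁ ℓ₂ c′ ℓ₁′ ℓ₂′} (𝔽q : HeytingField c ℓ₁ ℓ₂) (𝕂 : HeytingField c′ ℓ₁′ ℓ₂′) →
    let F = fieldRing 𝔽q
        K = fieldRing 𝕂
        open CommutativeRing K using (Carrier)
        open Matrices K
    in
    (q n t u : ℕ) .{{_ : NonZero n}} .{{_ : NonZero t}} .{{_ : NonZero u}} →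
    let open Linearized K q n t u in
    IsPrimePower q →
    gcd u n ≡ 1 →
    HasOrder F q →
    HasOrder K (q ^ (n * t)) →
    (ι : CommutativeRing.Carrier F → Carrier)
    (hom : IsRingHomomorphism (CommutativeRing.rawRing F) (CommutativeRing.rawRing K) ι) →
    let open Dimension F (restrictScalars F K hom) using (HasDimension) in
    (b : Vector Carrier t)
    (τ : Carrier → Carrier) → IsInverseOfσ τ →
    (s : ℕ) → IsLeast (IsExponentOf τ) s →
    (h : ℤ) →
    (∃[ d ] (+ d ≡ h × HasDimension (Ker b) d))
      ⇔ (∃[ r ] (+ r ≡ + t - h × HasRank (twistedProduct τ (D b) n ⊖ J ^ᴹ s) r))
theorem1p6 𝔽q 𝕂 q n t u q-primePower coprime orderF orderK ι hom b τ τ-inverse s ((_ , _ , τ≈Fr-s) , _) h =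
  mk⇔ to from
  where
  open LinearizedMatrix 𝕂 q n t u q-primePower orderK b
  open Kernel τ τ-inverse s τ≈Fr-s
  open RankNullity 𝕂 orderK using (rank-nullity; rank-exists)

  to : _ → _
  -- Some rank exists, and its sum with the given kernel dimension is `t`.
  to (d , +d≡h , dim) =
    let r , rank = rank-exists N
        d+r≡t = rank-nullity N (dim-Ker⇒nullity 𝔽q orderF coprime hom dim) rank
    in r , ≡.trans (+r≡+[d+r]-+d d r) (≡.cong₂ _-_ (≡.cong +_ d+r≡t) +d≡h) , rank

  from : _ → _
  -- Symmetrically, some kernel dimension exists and its sum with the given rank is `t`, which
  -- forces it to be `h`; in particular no `h` outside the range from 0 to `t` can occur.
  from (r , +r≡t-h , rank) =
    let d , dim = dim-Ker-exists 𝔽q orderF coprime hom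
        d+r≡t = rank-nullity N (dim-Ker⇒nullity 𝔽q orderF coprime hom dim) rank
    in d , ≡.trans (+r≡+[d+r]-+d r d) (≡.trans
         (≡.cong₂ _-_ (≡.cong +_ (≡.trans (ℕ.+-comm r d) d+r≡t)) +r≡t-h) (t-[t-h]≡h (+ t) h)) , dim
    where
    t-[t-h]≡h : ∀ i j → i - (i - j) ≡ j
    t-[t-h]≡h = ℤ-solve-∀
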